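{- Let $m$ be a positive integer and $\xi=e^{2\pi i/m}$. For $n\geq 1$ let $\overline{f}_m(n)$ be the number of Young tableaux with walls over the building $\mathcal{B}_m^n$, and set $\overline{f}_m(0)=1$. Then $$\overline{F}_m(x)=\sum_{n\geq 0}\overline{f}_m(n)x^n=\prod_{k=1}^{m}C(\xi^{k} x^{1/m})=\exp \left(\sum_{n\geq 1}\binom{2mn-1}{mn-1}\frac{x^n}{n}\right),$$ where $C(x)=\frac{1-\sqrt{1-4x}}{2x}=\sum_{n\geq 0}\frac{1}{n+1}\binom{2n}{n}x^n$ is the Catalan generating function.
   Context: A Young tableau with walls of shape $2\times N$ with wall set $W\subseteq\{1,\dots,N\}$ (a set of columns in which the horizontal edge between the two cells is a wall) is a filling of the $2N$ cells of a $2\times N$ rectangle with the labels $1,2,\dots,2N$, each used exactly once, such that the entries of each row increase from left to right, and for every column $c\notin W$ the entry of the first-row cell of column $c$ is smaller than the entry of the second-row cell of column $c$ (for columns $c\in W$ no condition between the two cells is imposed). The building $\mathcal{B}_m$ is the $2\times m$ rectangle with walls in all columns except the first, and $\mathcal{B}_m^n$ is obtained by concatenating $n$ copies of $\mathcal{B}_m$ horizontally: it is the $2\times mn$ rectangle with wall set $\{jm+i: 0\le j\le n-1,\ 2\le i\le m\}$. In the product, $x^{1/m}$ denotes a fixed formal $m$-th root of $x$; the product is a formal power series in $x$. -}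

module Defs where

open import Level using (0ℓ)
open import Data.Bool using (Bool; true; false; if_then_else_; not)
open import Data.Nat as ℕ using (ℕ; zero; suc; _∸_; NonZero)
open import Data.Nat.Properties using (_!≢0)
open import Data.Nat.DivMod using (_%_) renaming (_/_ to _div_)
open import Data.Nat.Divisibility using (_∣?_)
open import Data.Nat.Combinatorics using (_C_)
open import Data.Integer using (+_)
open import Data.Rational as ℚ using (ℚ)
open import Data.Fin as Fin using (Fin; toℕ)
open import Data.Fin.Properties using (all?; any?) renaming (_≟_ to _≟ᶠ_)
open import Data.List using (List; []; _∷_; concatMap; map; length; filter)
open import Data.Product using (Σ; ∃; ∃-syntax; _×_; _,_)
open import Relation.Binary.PropositionalEquality using (_≡_; _≢_)
open import Relation.Nullary using (Dec; yes; no; ¬_)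
open import Relation.Nullary.Decidable using (_×-dec_; _→-dec_)
open import Algebra.Bundles using (CommutativeRing)

-- Young tableaux with walls of shape 2 × N.
-- Cells are indexed by (row , column) : Fin 2 × Fin N (row 0 = first row,
-- columns 0-indexed: Fin-column c is the paper's column c+1).
-- Labels are Fin (2N); label ℓ stands for the paper's label ℓ+1
-- (an order-preserving renaming, so all conditions are unchanged).
-- A wall set W ⊆ {1..N} is given by its indicator W : Fin N → Bool.

Filling : ℕ → Set
Filling N = Fin 2 → Fin N → Fin (2 ℕ.* N)

LabelsBijective : ∀ {N} → Filling N → Set
LabelsBijective {N} t =
  (∀ r c r′ c′ → t r c ≡ t r′ c′ → (r ≡ r′ × c ≡ c′))
  × (∀ (ℓ : Fin (2 ℕ.* N)) → ∃[ r ] ∃[ c ] (t r c ≡ ℓ))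

RowsIncreasing : ∀ {N} → Filling N → Set
RowsIncreasing {N} t = ∀ r (c c′ : Fin N) → c Fin.< c′ → t r c Fin.< t r c′

ColumnsOK : ∀ {N} → (Fin N → Bool) → Filling N → Set
ColumnsOK {N} W t = ∀ (c : Fin N) → W c ≡ false →
  t Fin.zero c Fin.< t (Fin.suc Fin.zero) c

IsTableau : ∀ {N} → (Fin N → Bool) → Filling N → Set
IsTableau W t = LabelsBijective t × RowsIncreasing t × ColumnsOK W t

private
  boolDec : (b b′ : Bool) → Dec (b ≡ b′)
  boolDec false false = yes _≡_.refl
  boolDec false true  = no λ ()
  boolDec true  false = no λ ()
  boolDec true  true  = yes _≡_.refl

isTableau? : ∀ {N} (W : Fin N → Bool) (t : Filling N) → Dec (IsTableau W t)
isTableau? W t =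
  ((all? λ r → all? λ c → all? λ r′ → all? λ c′ →
       (t r c ≟ᶠ t r′ c′) →-dec ((r ≟ᶠ r′) ×-dec (c ≟ᶠ c′)))
   ×-dec (all? λ ℓ → any? λ r → any? λ c → t r c ≟ᶠ ℓ))
  ×-dec ((all? λ r → all? λ c → all? λ c′ →
            (c Fin.<? c′) →-dec (t r c Fin.<? t r c′))
  ×-dec (all? λ c → boolDec (W c) false →-dec (t Fin.zero c Fin.<? t (Fin.suc Fin.zero) c)))

allFuns : ∀ {A : Set} (n : ℕ) → List A → List (Fin n → A)
allFuns zero    xs = (λ ()) ∷ []
allFuns (suc n) xs =
  concatMap (λ a → map (λ f → λ { Fin.zero → a ; (Fin.suc i) → f i }) (allFuns n xs)) xs

allFillings : (N : ℕ) → List (Filling N)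
allFillings N = allFuns 2 (allFuns N (Data.List.tabulate {n = 2 ℕ.* N} (λ i → i)))
  where import Data.List

numTableaux : (N : ℕ) → (Fin N → Bool) → ℕ
numTableaux N W = length (filter (isTableau? W) (allFillings N))

-- wall set of the building B_m^n (on 2 × mn):  {jm+i : 0≤j≤n-1, 2≤i≤m}.
-- For the 0-indexed column c (paper column c+1) this is: c mod m ≠ 0.
buildingWalls : (m n : ℕ) → .{{NonZero m}} → Fin (m ℕ.* n) → Bool
buildingWalls m n c with toℕ c % m
... | zero  = false
... | suc _ = true

fbar : (m : ℕ) → .{{NonZero m}} → ℕ → ℕ
fbar m zero        = 1
fbar m n@(suc _)   = numTableaux (m ℕ.* n) (buildingWalls m n)

sumTo : ∀ {A : Set} → (A → A → A) → A → ℕ → (ℕ → A) → A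
sumTo _+_ z zero    h = _+_ z (h 0)
sumTo _+_ z (suc n) h = _+_ (sumTo _+_ z n h) (h (suc n))

mulPSℚ : (ℕ → ℚ) → (ℕ → ℚ) → ℕ → ℚ
mulPSℚ f g n = sumTo ℚ._+_ ℚ.0ℚ n (λ k → f k ℚ.* g (n ∸ k))

powPSℚ : (ℕ → ℚ) → ℕ → ℕ → ℚ
powPSℚ G zero    n = if ⌊ n ≟ 0 ⌋ then ℚ.1ℚ else ℚ.0ℚ
  where open import Data.Nat using (_≟_)
        open import Relation.Nullary.Decidable using (⌊_⌋)
powPSℚ G (suc k) = mulPSℚ G (powPSℚ G k)

-- exp(G) = Σ_k G^k / k!  for G with zero constant term;
-- the coefficient of x^n only receives contributions from k ≤ n.
expPSℚ : (ℕ → ℚ) → ℕ → ℚ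
expPSℚ G n = sumTo ℚ._+_ ℚ.0ℚ n
  (λ k → ((+ 1) ℚ./ (k ℕ.!)) {{k !≢0}} ℚ.* powPSℚ G k n)

expArg : ℕ → ℕ → ℚ
expArg m zero        = ℚ.0ℚ
expArg m n@(suc _)   = (+ ((2 ℕ.* m ℕ.* n ∸ 1) C (m ℕ.* n ∸ 1))) ℚ./ n

catalan : ℕ → ℕ
catalan n = ((2 ℕ.* n) C n) div (suc n)

module _ (K : CommutativeRing 0ℓ 0ℓ) where
  open CommutativeRing K

  natK : ℕ → Carrier
  natK zero    = 0#
  natK (suc n) = 1# + natK n

  powK : Carrier → ℕ → Carrier
  powK x zero    = 1#
  powK x (suc n) = x * powK x n

  IsField : Set
  IsField = (¬ (1# ≈ 0#)) × (∀ x → ¬ (x ≈ 0#) → ∃[ y ] (x * y ≈ 1#))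

  CharZero : Set
  CharZero = ∀ n → ¬ (natK (suc n) ≈ 0#)

  PrimitiveRoot : ℕ → Carrier → Set
  PrimitiveRoot m ξ = (powK ξ m ≈ 1#) × (∀ j → 0 ℕ.< j → j ℕ.< m → ¬ (powK ξ j ≈ 1#))

  mulPS : (ℕ → Carrier) → (ℕ → Carrier) → ℕ → Carrier
  mulPS f g n = sumTo _+_ 0# n (λ k → f k * g (n ∸ k))

  catalanAt : Carrier → ℕ → Carrier
  catalanAt a j = natK (catalan j) * powK a j

  -- ∏_{k=1}^{m} C(ξ^k y), as a power series in y (y plays the role of x^{1/m})
  prodCatalan : ℕ → Carrier → ℕ → Carrier
  prodCatalan zero    ξ j = if ⌊ j ≟ 0 ⌋ then 1# else 0#
    where open import Data.Nat using (_≟_)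
          open import Relation.Nullary.Decidable using (⌊_⌋)
  prodCatalan (suc k) ξ = mulPS (prodCatalan k ξ) (catalanAt (powK ξ (suc k)))

  -- F̄_m(y^m) as a power series in y
  FbarAtRoot : (m : ℕ) → .{{NonZero m}} → ℕ → Carrier
  FbarAtRoot m j with m ∣? j
  ... | yes _ = natK (fbar m (j div m))
  ... | no  _ = 0#

{-# OPTIONS --safe #-}

-- Reading the labels of a tableau over B_m^n from the largest to the smallest
-- gives a word with mn letters for each row, in which the (mk)-th second-row
-- letter is preceded by fewer than mk first-row letters.  Cut at these letters,
-- the word is a walk of n steps with step series φ/z^m, φ = 1/(1−z)^m, all of
-- whose partial sums are negative.  Let A be the generating series of such walks
-- (x marks steps, z the position, scaled so that the x^n coefficient is multiplied
-- by z^{mn}) and P the projection to negative positions.  Then A = 1 + P(xφA), and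
-- since P is a Rota–Baxter operator, Spitzer's identity holds in the form
--   x ∂A/∂x = P(1/(1 − xφ)) · A.
-- Setting z = 1 gives  n f(n) = Σ_k C(2mk−1, mk−1) f(n−k),  i.e. the logarithmic
-- derivative of the exponential formula.  For m = 1 it says that C(x) has
-- logarithmic derivative Σ C(2k−1, k−1) x^k, and averaging over the m-th roots of
-- unity keeps exactly the exponents divisible by m.

module Submission where

open import Defs
open import Level using (0ℓ)
open import Data.Bool using (false)
open import Data.Empty using (⊥-elim-irr)
open import Data.Fin as Fin using (Fin; toℕ; fromℕ<)
import Data.Fin.Properties as Fin
open import Data.Integer as ℤ using (+_)
import Data.Integer.Properties as ℤ
open import Data.List using (List; []; _∷_; _++_; length; map; filter)
open import Data.List.Properties using (length-map; length-++)
open import Data.List.Membership.Propositional using (_∈_; find; lose)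
open import Data.List.Membership.Propositional.Properties
  using (∈-map⁺; ∈-map⁻; ∈-++⁺ˡ; ∈-++⁺ʳ; ∈-filter⁺)
open import Data.List.Relation.Unary.All as All using (All; []; _∷_)
import Data.List.Relation.Unary.All.Properties as All
open import Data.List.Relation.Unary.AllPairs as AllPairs using (AllPairs; []; _∷_)
import Data.List.Relation.Unary.AllPairs.Properties as AllPairs
open import Data.List.Relation.Unary.Any as Any using (Any; here; there)
import Data.List.Relation.Unary.Any.Properties as Any
open import Data.List.Relation.Unary.Unique.Propositional using (Unique)
import Data.List.Relation.Unary.Unique.Propositional.Properties as Unique
open import Data.Nat as ℕ using (ℕ; zero; suc; _∸_; _≤_; _<_; z≤n; s≤s; NonZero; _!)
import Data.Nat.Properties as ℕ
open import Data.Nat.Combinatorics using (_C_; nCk+nC[k+1]≡[n+1]C[k+1]; nCk≡nC[n∸k]; nCn≡1)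
open import Data.Nat.Divisibility
  using (_∣_; _∣?_; divides; 1∣_; ∣-refl; ∣⇒≤; m∣m*n; ∣m∣n⇒∣m+n; ∣m+n∣m⇒∣n; ∣m∸n∣n⇒∣m; m%n≡0⇒n∣m; n∣m⇒m%n≡0)
open import Data.Nat.DivMod using (_%_; m≡m%n+[m/n]*n; m%n<n; m*n/n≡m) renaming (_/_ to _div_)
open import Data.Nat.Solver using (module +-*-Solver)
open import Data.Product using (∃-syntax; _×_; _,_; proj₁; proj₂)
open import Data.Rational as ℚ using (ℚ; _/_)
import Data.Rational.Properties as ℚ
open import Data.Rational.Unnormalised as ℚᵘ using (mkℚᵘ; *≡*)
import Data.Rational.Unnormalised.Properties as ℚᵘ
open import Data.Sum using (_⊎_; inj₁; inj₂)
open import Function using (_∘_)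
open import Relation.Binary.Definitions using (tri<; tri≈; tri>)
open import Relation.Binary.PropositionalEquality as ≡ using (_≡_; _≢_)
open import Relation.Nullary using (Dec; yes; no; ¬_; contradiction)
open import Relation.Nullary.Decidable using (_→-dec_)
open import Relation.Unary using (Decidable)
open import Algebra.Bundles using (CommutativeRing)
import Algebra.Properties.CommutativeSemigroup as CSProps
import Algebra.Properties.Group as GroupProps
import Algebra.Properties.Ring as RingProps
import Algebra.Solver.Ring.NaturalCoefficients.Default as NatSolver
import Relation.Binary.Reasoning.Setoid as SetoidReasoning

-- The obstacle to setting z = 1 at the outset is that φ is an infinite series in z. Only behind P
-- is everything polynomial: the x^n coefficients of A and of P(1/(1 - xφ)) have z-degree at most
-- mn, so evaluation at 1 is a finite sum and is multiplicative. On A it yields f(n) because the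
-- first-row letters after the last second-row letter are forced. On P(1/(1 - xφ)) it adds the
-- coefficients of 1/(1 - z)^M below z^M, where M = mk; this is the z^(M-1) coefficient of 1/(1 -
-- z)^(M+1), hence C(2M-1, M-1).
--
-- P is Rota-Baxter because the series supported on negative positions and those supported on
-- nonnegative positions are each closed under multiplication. Spitzer's identity then follows by
-- uniqueness: both sides solve one linear equation that determines them coefficient by coefficient.
--
-- With y^m = x, summing over the m roots multiplies each surviving coefficient by m, which is the
-- factor that y d/dy has over x d/dx. Both equalities of the theorem end with uniqueness for y F′ =
-- F h, where division by n uses characteristic zero.

-- Power series

module _ (R : CommutativeRing 0ℓ 0ℓ) where
  open CommutativeRing R
  open NatSolver commutativeSemiring

  -- The full product accounts for each of the four partial products once; the second copy of
  -- `a⁻ * b⁻` is left over. It is stated in an arbitrary ring because its use is in a ring of power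
  -- series.
  expand-parts : ∀ a⁻ a⁺ b⁻ b⁺ →
    (a⁻ * (b⁻ + b⁺) + (a⁻ + a⁺) * b⁻) + a⁺ * b⁺ ≈ a⁻ * b⁻ + (a⁻ + a⁺) * (b⁻ + b⁺)
  expand-parts = solve 4 (λ a⁻ a⁺ b⁻ b⁺ →
    (a⁻ :* (b⁻ :+ b⁺) :+ (a⁻ :+ a⁺) :* b⁻) :+ a⁺ :* b⁺
      := a⁻ :* b⁻ :+ (a⁻ :+ a⁺) :* (b⁻ :+ b⁺)) refl

module PowerSeries (K : CommutativeRing 0ℓ 0ℓ) where
  open CommutativeRing K
  open SetoidReasoning setoid
  open CSProps +-commutativeSemigroup using (interchange; x∙yz≈y∙xz)
  private
    module *-CS = CSProps *-commutativeSemigroup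

  ∑ : ℕ → (ℕ → Carrier) → Carrier
  ∑ = sumTo _+_ 0#

  ∑-cong : ∀ n {f g} → (∀ k → k ≤ n → f k ≈ g k) → ∑ n f ≈ ∑ n g
  ∑-cong zero    eq = +-congˡ (eq 0 z≤n)
  ∑-cong (suc n) eq =
    +-cong (∑-cong n λ k k≤n → eq k (ℕ.m≤n⇒m≤1+n k≤n)) (eq (suc n) ℕ.≤-refl)

  ∑-zero : ∀ n {f} → (∀ k → k ≤ n → f k ≈ 0#) → ∑ n f ≈ 0#
  ∑-zero zero    eq = trans (+-identityˡ _) (eq 0 z≤n)
  ∑-zero (suc n) eq = trans
    (+-cong (∑-zero n λ k k≤n → eq k (ℕ.m≤n⇒m≤1+n k≤n)) (eq (suc n) ℕ.≤-refl))
    (+-identityˡ 0#)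

  ∑-+ : ∀ n f g → ∑ n (λ k → f k + g k) ≈ ∑ n f + ∑ n g
  ∑-+ zero    f g = trans (+-congʳ (sym (+-identityˡ 0#))) (interchange 0# 0# (f 0) (g 0))
  ∑-+ (suc n) f g = trans (+-congʳ (∑-+ n f g)) (interchange _ _ _ _)

  *-distribˡ-∑ : ∀ n c f → c * ∑ n f ≈ ∑ n (λ k → c * f k)
  *-distribˡ-∑ zero    c f = trans (distribˡ c 0# (f 0)) (+-congʳ (zeroʳ c))
  *-distribˡ-∑ (suc n) c f = trans (distribˡ c _ _) (+-congʳ (*-distribˡ-∑ n c f))

  *-distribʳ-∑ : ∀ n c f → ∑ n f * c ≈ ∑ n (λ k → f k * c)
  *-distribʳ-∑ n c f = begin
    ∑ n f * c           ≈⟨ *-comm _ c ⟩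
    c * ∑ n f           ≈⟨ *-distribˡ-∑ n c f ⟩
    ∑ n (λ k → c * f k) ≈⟨ ∑-cong n (λ k _ → *-comm c (f k)) ⟩
    ∑ n (λ k → f k * c) ∎

  ∑-head : ∀ n f → ∑ (suc n) f ≈ f 0 + ∑ n (λ k → f (suc k))
  ∑-head zero    f = +-cong (+-identityˡ _) (sym (+-identityˡ _))
  ∑-head (suc n) f = trans (+-congʳ (∑-head n f)) (+-assoc _ _ _)

  ∑-reverse : ∀ n f → ∑ n f ≈ ∑ n (λ k → f (n ∸ k))
  ∑-reverse zero    f = refl
  ∑-reverse (suc n) f = begin
    ∑ n f + f (suc n)                 ≈⟨ +-comm _ _ ⟩
    f (suc n) + ∑ n f                 ≈⟨ +-congˡ (∑-reverse n f) ⟩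
    f (suc n) + ∑ n (λ k → f (n ∸ k)) ≈⟨ ∑-head n (λ k → f (suc n ∸ k)) ⟨
    ∑ (suc n) (λ k → f (suc n ∸ k))   ∎

  ∑-swap : ∀ n N (F : ℕ → ℕ → Carrier) → ∑ n (λ k → ∑ N (F k)) ≈ ∑ N (λ i → ∑ n (λ k → F k i))
  ∑-swap zero    N F = trans (+-identityˡ _) (∑-cong N λ i _ → sym (+-identityˡ _))
  ∑-swap (suc n) N F = trans (+-congʳ (∑-swap n N F)) (sym (∑-+ N _ _))

  -- The triangle i + j ≤ n is summed along its diagonals and along its rows; this exchange is what
  -- makes convolution associative.
  ∑-triangle : ∀ n (F : ℕ → ℕ → Carrier) →
    ∑ n (λ k → ∑ k (λ i → F i (k ∸ i))) ≈ ∑ n (λ i → ∑ (n ∸ i) (F i))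
  ∑-triangle zero    F = refl
  ∑-triangle (suc n) F = begin
    ∑ n (λ k → ∑ k (λ i → F i (k ∸ i))) + (∑ n (λ i → F i (suc n ∸ i)) + F (suc n) (n ∸ n))
      ≈⟨ +-assoc _ _ _ ⟨
    (∑ n (λ k → ∑ k (λ i → F i (k ∸ i))) + ∑ n (λ i → F i (suc n ∸ i))) + F (suc n) (n ∸ n)
      ≈⟨ +-cong (+-congʳ (∑-triangle n F)) corner ⟩
    (∑ n (λ i → ∑ (n ∸ i) (F i)) + ∑ n (λ i → F i (suc n ∸ i))) + ∑ (n ∸ n) (F (suc n))
      ≈⟨ +-congʳ (∑-+ n _ _) ⟨
    ∑ n (λ i → ∑ (n ∸ i) (F i) + F i (suc n ∸ i)) + ∑ (n ∸ n) (F (suc n))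
      ≈⟨ +-congʳ (∑-cong n column) ⟩
    ∑ n (λ i → ∑ (suc n ∸ i) (F i)) + ∑ (n ∸ n) (F (suc n)) ∎
    where
    corner : F (suc n) (n ∸ n) ≈ ∑ (n ∸ n) (F (suc n))
    corner rewrite ℕ.n∸n≡0 n = sym (+-identityˡ _)
    column : ∀ i → i ≤ n → ∑ (n ∸ i) (F i) + F i (suc n ∸ i) ≈ ∑ (suc n ∸ i) (F i)
    column i i≤n rewrite ℕ.+-∸-assoc 1 i≤n = refl

  ∑-extend : ∀ n d {f} → (∀ k → n < k → f k ≈ 0#) → ∑ (d ℕ.+ n) f ≈ ∑ n f
  ∑-extend n zero    f≈0 = refl
  ∑-extend n (suc d) f≈0 = trans
    (+-cong (∑-extend n d f≈0) (f≈0 _ (s≤s (ℕ.m≤n+m n d)))) (+-identityʳ _)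

  infix  4 _≋_
  infixl 7 _⊛_
  infixl 6 _⊕_

  _≋_ : (f g : ℕ → Carrier) → Set
  f ≋ g = ∀ n → f n ≈ g n

  _⊛_ _⊕_ : (f g : ℕ → Carrier) → ℕ → Carrier
  _⊛_ = mulPS K
  (f ⊕ g) n = f n + g n

  one : ℕ → Carrier
  one zero    = 1#
  one (suc _) = 0#

  ⊛-cong : ∀ {f f′ g g′} → f ≋ f′ → g ≋ g′ → f ⊛ g ≋ f′ ⊛ g′
  ⊛-cong f≋f′ g≋g′ n = ∑-cong n λ k _ → *-cong (f≋f′ k) (g≋g′ (n ∸ k))

  ⊛-comm : ∀ f g → f ⊛ g ≋ g ⊛ f
  ⊛-comm f g n = begin
    ∑ n (λ k → f k * g (n ∸ k))             ≈⟨ ∑-reverse n _ ⟩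
    ∑ n (λ k → f (n ∸ k) * g (n ∸ (n ∸ k))) ≈⟨ ∑-cong n (λ k k≤n → trans (*-comm _ _)
                                                (*-congʳ (reflexive (≡.cong g (ℕ.m∸[m∸n]≡n k≤n))))) ⟩
    ∑ n (λ k → g k * f (n ∸ k))             ∎

  ⊛-assoc : ∀ f g h → (f ⊛ g) ⊛ h ≋ f ⊛ (g ⊛ h)
  ⊛-assoc f g h n = begin
    ∑ n (λ k → (f ⊛ g) k * h (n ∸ k))
      ≈⟨ ∑-cong n (λ k _ → *-distribʳ-∑ k _ _) ⟩
    ∑ n (λ k → ∑ k (λ i → f i * g (k ∸ i) * h (n ∸ k)))
      ≈⟨ ∑-cong n (λ k _ → ∑-cong k (λ i i≤k → trans (*-assoc _ _ _)
           (*-congˡ (*-congˡ (reflexive (≡.cong (λ j → h (n ∸ j)) (≡.sym (ℕ.m+[n∸m]≡n i≤k)))))))) ⟩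
    ∑ n (λ k → ∑ k (λ i → f i * (g (k ∸ i) * h (n ∸ (i ℕ.+ (k ∸ i))))))
      ≈⟨ ∑-triangle n (λ i j → f i * (g j * h (n ∸ (i ℕ.+ j)))) ⟩
    ∑ n (λ i → ∑ (n ∸ i) (λ j → f i * (g j * h (n ∸ (i ℕ.+ j)))))
      ≈⟨ ∑-cong n (λ i _ → trans (*-distribˡ-∑ (n ∸ i) (f i) (λ j → g j * h (n ∸ i ∸ j)))
           (∑-cong (n ∸ i) λ j _ → *-congˡ (*-congˡ (reflexive (≡.cong h (ℕ.∸-+-assoc n i j)))))) ⟨
    ∑ n (λ i → f i * (g ⊛ h) (n ∸ i)) ∎

  -- Serves both the unit law and the shift law `B⊛-suc`: dropping the first coefficient of `B`
  -- leaves a constant series.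
  constant-⊛ : ∀ {c} f → (∀ k → c (suc k) ≈ 0#) → ∀ n → (c ⊛ f) n ≈ c 0 * f n
  constant-⊛ f c≈0 zero    = +-identityˡ _
  constant-⊛ f c≈0 (suc n) = trans (∑-head n _) (trans
    (+-congˡ (∑-zero n λ k _ → trans (*-congʳ (c≈0 k)) (zeroˡ _))) (+-identityʳ _))

  ⊛-identityˡ : ∀ f → one ⊛ f ≋ f
  ⊛-identityˡ f n = trans (constant-⊛ f (λ _ → refl) n) (*-identityˡ _)

  ⊛-distribˡ : ∀ f g h → f ⊛ (g ⊕ h) ≋ (f ⊛ g) ⊕ (f ⊛ h)
  ⊛-distribˡ f g h n = trans (∑-cong n λ k _ → distribˡ _ _ _) (∑-+ n _ _)

  -- Packaged as a ring so that `PowerSeries` can be applied twice, giving series in x whose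
  -- coefficients are series in z.
  seriesRing : CommutativeRing 0ℓ 0ℓ
  seriesRing = record
    { Carrier = ℕ → Carrier
    ; _≈_ = _≋_
    ; _+_ = _⊕_
    ; _*_ = _⊛_
    ; -_  = λ f n → - f n
    ; 0#  = λ _ → 0#
    ; 1#  = one
    ; isCommutativeRing = record
      { isRing = record
        { +-isAbelianGroup = record
          { isGroup = record
            { isMonoid = record
              { isSemigroup = record
                { isMagma = record
                  { isEquivalence = record
                    { refl  = λ _ → refl
                    ; sym   = λ p n → sym (p n)
                    ; trans = λ p q n → trans (p n) (q n)
                    }
                  ; ∙-cong = λ p q n → +-cong (p n) (q n)
                  }
                ; assoc = λ f g h n → +-assoc _ _ _
                }
              ; identity = (λ f n → +-identityˡ _) , (λ f n → +-identityʳ _)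
              }
            ; inverse = (λ f n → -‿inverseˡ _) , (λ f n → -‿inverseʳ _)
            ; ⁻¹-cong = λ p n → -‿cong (p n)
            }
          ; comm = λ f g n → +-comm _ _
          }
        ; *-cong = ⊛-cong
        ; *-assoc = ⊛-assoc
        ; *-identity = ⊛-identityˡ , (λ f n → trans (⊛-comm f one n) (⊛-identityˡ f n))
        ; distrib = ⊛-distribˡ , (λ f g h n → trans (⊛-comm (g ⊕ h) f n)
            (trans (⊛-distribˡ f g h n) (+-cong (⊛-comm f g n) (⊛-comm f h n))))
        }
      ; *-comm = ⊛-comm
      }
    }

  natK-+ : ∀ a b → natK K (a ℕ.+ b) ≈ natK K a + natK K b
  natK-+ zero    b = sym (+-identityˡ _)
  natK-+ (suc a) b = trans (+-congˡ (natK-+ a b)) (sym (+-assoc _ _ _))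

  natK-* : ∀ a b → natK K (a ℕ.* b) ≈ natK K a * natK K b
  natK-* zero    b = sym (zeroˡ _)
  natK-* (suc a) b = begin
    natK K (b ℕ.+ a ℕ.* b)                 ≈⟨ natK-+ b (a ℕ.* b) ⟩
    natK K b + natK K (a ℕ.* b)            ≈⟨ +-cong (sym (*-identityˡ _)) (natK-* a b) ⟩
    1# * natK K b + natK K a * natK K b    ≈⟨ distribʳ _ _ _ ⟨
    natK K (suc a) * natK K b              ∎

  powK-cong : ∀ {x y} n → x ≈ y → powK K x n ≈ powK K y n
  powK-cong zero    eq = refl
  powK-cong (suc n) eq = *-cong eq (powK-cong n eq)

  powK-+ : ∀ x a b → powK K x (a ℕ.+ b) ≈ powK K x a * powK K x b
  powK-+ x zero    b = sym (*-identityˡ _)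
  powK-+ x (suc a) b = trans (*-congˡ (powK-+ x a b)) (sym (*-assoc _ _ _))

  powK-one : ∀ n → powK K 1# n ≈ 1#
  powK-one zero    = refl
  powK-one (suc n) = trans (*-identityˡ _) (powK-one n)

  powK-* : ∀ x a b → powK K x (a ℕ.* b) ≈ powK K (powK K x a) b
  powK-* x a zero    rewrite ℕ.*-zeroʳ a = refl
  powK-* x a (suc b) rewrite ℕ.*-suc a b = trans (powK-+ x a (a ℕ.* b)) (*-congˡ (powK-* x a b))

  -- The Euler operator x d/dx. Unlike d/dx it keeps the exponent, so it commutes with any operation
  -- that is additive on each coefficient.
  D : (ℕ → Carrier) → ℕ → Carrier
  D f n = natK K n * f n

  D-cong : ∀ {f g} → f ≋ g → D f ≋ D g
  D-cong f≋g n = *-congˡ (f≋g n)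

  D-⊛ : ∀ f g → D (f ⊛ g) ≋ (D f ⊛ g) ⊕ (f ⊛ D g)
  D-⊛ f g n = begin
    natK K n * ∑ n (λ k → f k * g (n ∸ k))
      ≈⟨ *-distribˡ-∑ n _ _ ⟩
    ∑ n (λ k → natK K n * (f k * g (n ∸ k)))
      ≈⟨ ∑-cong n leibniz ⟩
    ∑ n (λ k → D f k * g (n ∸ k) + f k * D g (n ∸ k))
      ≈⟨ ∑-+ n _ _ ⟩
    (D f ⊛ g) n + (f ⊛ D g) n ∎
    where
    leibniz : ∀ k → k ≤ n →
      natK K n * (f k * g (n ∸ k)) ≈ D f k * g (n ∸ k) + f k * D g (n ∸ k)
    leibniz k k≤n = begin
      natK K n * (f k * g (n ∸ k))
        ≡⟨ ≡.cong (λ j → natK K j * (f k * g (n ∸ k))) (ℕ.m+[n∸m]≡n k≤n) ⟨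
      natK K (k ℕ.+ (n ∸ k)) * (f k * g (n ∸ k))
        ≈⟨ trans (*-congʳ (natK-+ k (n ∸ k))) (distribʳ _ _ _) ⟩
      natK K k * (f k * g (n ∸ k)) + natK K (n ∸ k) * (f k * g (n ∸ k))
        ≈⟨ +-cong (sym (*-assoc _ _ _)) (*-CS.x∙yz≈y∙xz _ _ _) ⟩
      D f k * g (n ∸ k) + f k * D g (n ∸ k) ∎

  trunc : ℕ → (ℕ → Carrier) → ℕ → Carrier
  trunc M f e with e ℕ.<? M
  ... | yes _ = f e
  ... | no  _ = 0#

  trunc-< : ∀ {M e} f → e < M → trunc M f e ≈ f e
  trunc-< {M} {e} f e<M with e ℕ.<? M
  ... | yes _  = refl
  ... | no e≮M = contradiction e<M e≮M

  trunc-≥ : ∀ {M e} f → M ≤ e → trunc M f e ≈ 0#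
  trunc-≥ {M} {e} f M≤e with e ℕ.<? M
  ... | yes e<M = contradiction M≤e (ℕ.<⇒≱ e<M)
  ... | no  _   = refl

  trunc-cong : ∀ M {f g} → f ≋ g → trunc M f ≋ trunc M g
  trunc-cong M f≋g e with e ℕ.<? M
  ... | yes _ = f≋g e
  ... | no  _ = refl

  trunc-⊕ : ∀ M f g → trunc M (f ⊕ g) ≋ trunc M f ⊕ trunc M g
  trunc-⊕ M f g e with e ℕ.<? M
  ... | yes _ = refl
  ... | no  _ = sym (+-identityˡ 0#)

  trunc-idem : ∀ M f → trunc M (trunc M f) ≋ trunc M f
  trunc-idem M f e with e ℕ.<? M in eq
  ... | yes _ rewrite eq = refl
  ... | no  _ = refl

  trunc-zero : ∀ M {f} → (∀ e → e < M → f e ≈ 0#) → ∀ e → trunc M f e ≈ 0#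
  trunc-zero M f≈0 e with e ℕ.<? M
  ... | yes e<M = f≈0 e e<M
  ... | no  _   = refl

  -- Graded form of the weight −1 Rota–Baxter identity, with the product
  -- moved to the right so that no subtraction occurs.
  trunc-RotaBaxter : ∀ M L a b →
    trunc (M ℕ.+ L) ((trunc M a ⊛ b) ⊕ (a ⊛ trunc L b))
      ≋ (trunc M a ⊛ trunc L b) ⊕ trunc (M ℕ.+ L) (a ⊛ b)
  trunc-RotaBaxter M L a b e = begin
    -- The product `a⁺ ⊛ b⁺` has no terms below degree M + L, so the cut erases it and it can be
    -- added freely. All of `a⁻ ⊛ b⁻` lies below M + L, so the cut leaves it intact.
    T inner e                           ≈⟨ +-identityʳ _ ⟨
    T inner e + 0#                      ≈⟨ +-congˡ (trunc-zero (M ℕ.+ L) high-vanishes e) ⟨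
    T inner e + T (a⁺ ⊛ b⁺) e           ≈⟨ trunc-⊕ (M ℕ.+ L) inner (a⁺ ⊛ b⁺) e ⟨
    T (inner ⊕ (a⁺ ⊛ b⁺)) e             ≈⟨ trunc-cong (M ℕ.+ L) expand e ⟩
    T ((a⁻ ⊛ b⁻) ⊕ (a ⊛ b)) e           ≈⟨ trunc-⊕ (M ℕ.+ L) (a⁻ ⊛ b⁻) (a ⊛ b) e ⟩
    T (a⁻ ⊛ b⁻) e + T (a ⊛ b) e         ≈⟨ +-congʳ low-stays ⟩
    (a⁻ ⊛ b⁻) e + T (a ⊛ b) e           ∎
    where
    module S = CommutativeRing seriesRing
    T = trunc (M ℕ.+ L)
    a⁻ = trunc M a
    b⁻ = trunc L b
    a⁺ b⁺ : ℕ → Carrier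
    a⁺ = a S.- a⁻
    b⁺ = b S.- b⁻
    inner = (a⁻ ⊛ b) ⊕ (a ⊛ b⁻)
    split : ∀ c c⁻ → c S.≈ c⁻ S.+ (c S.- c⁻)
    split c c⁻ n = begin
      c n                   ≈⟨ +-identityʳ _ ⟨
      c n + 0#              ≈⟨ +-congˡ (-‿inverseʳ (c⁻ n)) ⟨
      c n + (c⁻ n - c⁻ n)   ≈⟨ x∙yz≈y∙xz _ _ _ ⟩
      c⁻ n + (c n - c⁻ n)   ∎
    vanish : ∀ {N} c → ∀ k → k < N → (c S.- trunc N c) k ≈ 0#
    vanish c k k<N = trans (+-congˡ (-‿cong (trunc-< c k<N))) (-‿inverseʳ _)
    high-vanishes : ∀ k → k < M ℕ.+ L → (a⁺ ⊛ b⁺) k ≈ 0#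
    high-vanishes k k<M+L = ∑-zero k term
      where
      term : ∀ i → i ≤ k → a⁺ i * b⁺ (k ∸ i) ≈ 0#
      term i i≤k with ℕ.<-≤-connex i M
      ... | inj₁ i<M = trans (*-congʳ (vanish a i i<M)) (zeroˡ _)
      ... | inj₂ M≤i = trans (*-congˡ (vanish b (k ∸ i) k∸i<L)) (zeroʳ _)
        where
        k∸i<L : k ∸ i < L
        k∸i<L = ℕ.+-cancelˡ-< i _ _ (ℕ.<-≤-trans
          (≡.subst (_< M ℕ.+ L) (≡.sym (ℕ.m+[n∸m]≡n i≤k)) k<M+L)
          (ℕ.+-monoˡ-≤ L M≤i))
    low-vanishes : M ℕ.+ L ≤ e → (a⁻ ⊛ b⁻) e ≈ 0#
    low-vanishes M+L≤e = ∑-zero e term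
      where
      term : ∀ i → i ≤ e → a⁻ i * b⁻ (e ∸ i) ≈ 0#
      term i i≤e with ℕ.<-≤-connex i M
      ... | inj₂ M≤i = trans (*-congʳ (trunc-≥ a M≤i)) (zeroˡ _)
      ... | inj₁ i<M = trans (*-congˡ (trunc-≥ b L≤e∸i)) (zeroʳ _)
        where
        L≤e∸i : L ≤ e ∸ i
        L≤e∸i = ℕ.m+n≤o⇒m≤o∸n L (ℕ.≤-trans
          (≡.subst (L ℕ.+ i ≤_) (ℕ.+-comm L M) (ℕ.+-monoʳ-≤ L (ℕ.<⇒≤ i<M))) M+L≤e)
    low-stays : T (a⁻ ⊛ b⁻) e ≈ (a⁻ ⊛ b⁻) e
    low-stays with e ℕ.<? (M ℕ.+ L)
    ... | yes _   = refl
    ... | no  e≮  = sym (low-vanishes (ℕ.≮⇒≥ e≮))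
    expand : inner ⊕ (a⁺ ⊛ b⁺) ≋ (a⁻ ⊛ b⁻) ⊕ (a ⊛ b)
    expand = S.trans
      (S.+-congʳ (S.+-cong (S.*-congˡ {a⁻} (split b b⁻)) (S.*-congʳ {b⁻} (split a a⁻))))
      (S.trans (expand-parts seriesRing a⁻ a⁺ b⁻ b⁺) (S.+-congˡ {a⁻ ⊛ b⁻} (S.sym (S.*-cong (split a a⁻) (split b b⁻)))))

-- Spitzer's identity

-- The algebraic core of Spitzer's identity: in a Rota–Baxter algebra, with
-- Φ = 1/(1 − B) and A = 1 + P(BA), the element P(Φ)A solves X = P(BX) + P(A).
module RotaBaxter (R : CommutativeRing 0ℓ 0ℓ) where
  open CommutativeRing R
  open SetoidReasoning setoid
  open NatSolver commutativeSemiring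

  module _
    (P : Carrier → Carrier)
    (P-cong : ∀ {f g} → f ≈ g → P f ≈ P g)
    (P-+ : ∀ f g → P (f + g) ≈ P f + P g)
    (P-RotaBaxter : ∀ a b → P (P a * b + a * P b) ≈ P a * P b + P (a * b))
    where

    PΦA-fixpoint : ∀ {A B Φ} → A ≈ 1# + P (B * A) → Φ ≈ 1# + B * Φ →
      P Φ * A ≈ P (B * (P Φ * A)) + P A
    -- Unfolding `A` produces `P Φ * P BA`. Adding `P ΦBA` to both sides completes it to the
    -- right-hand side of the Rota-Baxter identity at `Φ` and `BA`, and the addend is cancelled at
    -- the end.
    PΦA-fixpoint {A} {B} {Φ} A-unfold Φ-unfold = GroupProps.∙-cancelʳ +-group (P ΦBA) _ _ (begin
      P Φ * A + P ΦBA
        ≈⟨ +-congʳ (trans (*-congˡ A-unfold) (distribˡ _ _ _)) ⟩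
      (P Φ * 1# + P Φ * P BA) + P ΦBA
        ≈⟨ trans (+-assoc _ _ _) (+-cong (*-identityʳ _) (sym (P-RotaBaxter Φ BA))) ⟩
      P Φ + P (P Φ * BA + Φ * P BA)
        ≈⟨ P-+ _ _ ⟨
      P (Φ + (P Φ * BA + Φ * P BA))
        ≈⟨ P-cong regroup ⟩
      P ((B * (P Φ * A) + A) + ΦBA)
        ≈⟨ trans (P-+ _ _) (+-congʳ (P-+ _ _)) ⟩
      (P (B * (P Φ * A)) + P A) + P ΦBA ∎)
      where
      BA = B * A
      ΦBA = Φ * BA
      regroup : Φ + (P Φ * BA + Φ * P BA) ≈ (B * (P Φ * A) + A) + ΦBA
      regroup = begin
        Φ + (P Φ * BA + Φ * P BA)
          ≈⟨ +-congʳ (*-identityʳ Φ) ⟨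
        Φ * 1# + (P Φ * BA + Φ * P BA)
          ≈⟨ solve 6 (λ Φ T B A Q o → Φ :* o :+ (T :* (B :* A) :+ Φ :* Q)
               := B :* (T :* A) :+ Φ :* (o :+ Q)) refl Φ (P Φ) B A (P BA) 1# ⟩
        B * (P Φ * A) + Φ * (1# + P BA)
          ≈⟨ +-congˡ (*-congˡ (sym A-unfold)) ⟩
        B * (P Φ * A) + Φ * A
          ≈⟨ +-congˡ (*-congʳ Φ-unfold) ⟩
        B * (P Φ * A) + (1# + B * Φ) * A
          ≈⟨ solve 5 (λ Φ T B A o → B :* (T :* A) :+ (o :+ B :* Φ) :* A
               := (B :* (T :* A) :+ o :* A) :+ Φ :* (B :* A)) refl Φ (P Φ) B A 1# ⟩
        (B * (P Φ * A) + 1# * A) + ΦBA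
          ≈⟨ +-congʳ (+-congˡ (*-identityˡ A)) ⟩
        (B * (P Φ * A) + A) + ΦBA ∎

module SpitzerIdentity
  (K : CommutativeRing 0ℓ 0ℓ) (m : ℕ)
  (φ : ℕ → CommutativeRing.Carrier K)
  (A : ℕ → ℕ → CommutativeRing.Carrier K)
  where
  open PowerSeries K using (seriesRing; trunc; trunc-cong; trunc-⊕; trunc-zero; trunc-idem; trunc-RotaBaxter)
  open PowerSeries seriesRing
    using (∑; ∑-cong; ∑-+; ∑-head; constant-⊛; one; _≋_; _⊛_; _⊕_; D; D-cong; D-⊛)
    renaming (seriesRing to seriesRing₂)
  private
    module S  = CommutativeRing seriesRing
    module S₂ = CommutativeRing seriesRing₂

  -- In the coefficient of x^n the exponent e stands for position e - mn, so the negative positions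
  -- are the exponents below mn.
  P : (ℕ → S.Carrier) → ℕ → S.Carrier
  P f n = trunc (m ℕ.* n) (f n)

  -- `B` is xφ, and `Φ` is the geometric series 1/(1 - xφ), with x^n coefficient φ^n.
  B Φ T : ℕ → S.Carrier
  B 1 = φ
  B _ = S.0#
  Φ = powK seriesRing φ
  T = P Φ

  P-cong : ∀ {f g} → f ≋ g → P f ≋ P g
  P-cong f≋g n = trunc-cong (m ℕ.* n) (f≋g n)

  P-⊕ : ∀ f g → P (f ⊕ g) ≋ P f ⊕ P g
  P-⊕ f g n = trunc-⊕ (m ℕ.* n) (f n) (g n)

  trunc-∑ : ∀ M n f → trunc M (∑ n f) S.≈ ∑ n (λ k → trunc M (f k))
  trunc-∑ M zero    f = S.trans (trunc-⊕ M S.0# (f 0))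
    (S.+-congʳ {trunc M (f 0)} (trunc-zero M λ _ _ → CommutativeRing.refl K))
  trunc-∑ M (suc n) f = S.trans (trunc-⊕ M (∑ n f) (f (suc n)))
    (S.+-congʳ {trunc M (f (suc n))} (trunc-∑ M n f))

  -- The cuts mk and m(n - k) of the two factors add up to the cut mn of the product, so
  -- `trunc-RotaBaxter` applies to every summand of the convolution.
  P-RotaBaxter : ∀ a b → P ((P a ⊛ b) ⊕ (a ⊛ P b)) ≋ (P a ⊛ P b) ⊕ P (a ⊛ b)
  P-RotaBaxter a b n = begin
    trunc N (∑ n (λ k → P a k S.* b (n ∸ k)) S.+ ∑ n (λ k → a k S.* P b (n ∸ k)))
      ≈⟨ trunc-cong N (∑-+ n (λ k → P a k S.* b (n ∸ k)) (λ k → a k S.* P b (n ∸ k))) ⟨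
    trunc N (∑ n (λ k → P a k S.* b (n ∸ k) S.+ a k S.* P b (n ∸ k)))
      ≈⟨ trunc-∑ N n _ ⟩
    ∑ n (λ k → trunc N (P a k S.* b (n ∸ k) S.+ a k S.* P b (n ∸ k)))
      ≈⟨ ∑-cong n term ⟩
    ∑ n (λ k → P a k S.* P b (n ∸ k) S.+ trunc N (a k S.* b (n ∸ k)))
      ≈⟨ ∑-+ n (λ k → P a k S.* P b (n ∸ k)) (λ k → trunc N (a k S.* b (n ∸ k))) ⟩
    (P a ⊛ P b) n S.+ ∑ n (λ k → trunc N (a k S.* b (n ∸ k)))
      ≈⟨ S.+-congˡ {(P a ⊛ P b) n} (trunc-∑ N n (λ k → a k S.* b (n ∸ k))) ⟨
    (P a ⊛ P b) n S.+ P (a ⊛ b) n ∎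
    where
    open SetoidReasoning S.setoid
    N = m ℕ.* n
    term : ∀ k → k ≤ n →
      trunc N (P a k S.* b (n ∸ k) S.+ a k S.* P b (n ∸ k))
        S.≈ P a k S.* P b (n ∸ k) S.+ trunc N (a k S.* b (n ∸ k))
    term k k≤n = ≡.subst
      (λ M → trunc M (P a k S.* b (n ∸ k) S.+ a k S.* P b (n ∸ k))
        S.≈ P a k S.* P b (n ∸ k) S.+ trunc M (a k S.* b (n ∸ k)))
      (≡.trans (≡.sym (ℕ.*-distribˡ-+ m k (n ∸ k))) (≡.cong (m ℕ.*_) (ℕ.m+[n∸m]≡n k≤n)))
      (trunc-RotaBaxter (m ℕ.* k) (m ℕ.* (n ∸ k)) (a k) (b (n ∸ k)))

  -- The empty walk is at position 0, which is not negative: for n = 0 the cut is at 0 and nothing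
  -- survives it.
  P-one : P one ≋ S₂.0#
  P-one zero    rewrite ℕ.*-zeroʳ m = trunc-zero 0 {S.1#} λ _ ()
  P-one (suc n) = trunc-zero (m ℕ.* suc n) λ _ _ → CommutativeRing.refl K

  B⊛-zero : ∀ f → (B ⊛ f) 0 S.≈ S.0#
  B⊛-zero f = S.trans (S.+-identityˡ _) (S.zeroˡ (f 0))

  B⊛-suc : ∀ f n → (B ⊛ f) (suc n) S.≈ φ S.* f n
  B⊛-suc f n = S.trans (∑-head n (λ k → B k S.* f (suc n ∸ k)))
    (S.trans (S.+-congʳ (S.zeroˡ (f (suc n))))
      (S.trans (S.+-identityˡ _) (constant-⊛ {λ k → B (suc k)} f (λ _ → S.refl) n)))

  Φ-unfold : Φ ≋ one ⊕ (B ⊛ Φ)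
  Φ-unfold zero    = S.sym (S.trans (S.+-congˡ {S.1#} (B⊛-zero Φ)) (S.+-identityʳ S.1#))
  Φ-unfold (suc n) = S.sym (S.trans (S.+-identityˡ _) (B⊛-suc Φ n))

  D-P : ∀ f → D (P f) ≋ P (D f)
  D-P f n = S.sym (go n)
    where
    -- The factor k is decoupled from n, so that the induction leaves the cut fixed.
    go : ∀ k → trunc (m ℕ.* n) (natK seriesRing k S.* f n) S.≈ natK seriesRing k S.* P f n
    go zero    = S.trans (trunc-cong (m ℕ.* n) (S.zeroˡ (f n)))
      (S.trans (trunc-zero (m ℕ.* n) λ _ _ → CommutativeRing.refl K) (S.sym (S.zeroˡ (P f n))))
    go (suc k) = S.trans (trunc-cong (m ℕ.* n) (1+ (f n)))
      (S.trans (trunc-⊕ (m ℕ.* n) (f n) _)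
        (S.trans (S.+-congˡ {P f n} (go k)) (S.sym (1+ (P f n)))))
      where
      1+ : ∀ g → natK seriesRing (suc k) S.* g S.≈ g S.+ natK seriesRing k S.* g
      1+ g = S.trans (S.distribʳ g S.1# (natK seriesRing k)) (S.+-congʳ (S.*-identityˡ g))

  D-one : D one ≋ S₂.0#
  D-one zero    = S.zeroˡ S.1#
  D-one (suc n) = S.zeroʳ (natK seriesRing (suc n))

  D-B : D B ≋ B
  D-B zero          = S.zeroˡ S.0#
  D-B (suc zero)    = S.trans (S.*-congʳ {φ} (S.+-identityʳ S.1#)) (S.*-identityˡ φ)
  D-B (suc (suc n)) = S.zeroʳ (natK seriesRing (suc (suc n)))

  -- `B` has no constant term in x, so the x^(n+1) coefficient of P(BX) depends only on the x^n
  -- coefficient of X.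
  P-B-unique : ∀ {X Y Z} → X ≋ P (B ⊛ X) ⊕ Z → Y ≋ P (B ⊛ Y) ⊕ Z → X ≋ Y
  P-B-unique {X} {Y} {Z} X-eq Y-eq n =
    S.trans (X-eq n) (S.trans (S.+-congʳ {Z n} (trunc-cong (m ℕ.* n) (step n))) (S.sym (Y-eq n)))
    where
    step : ∀ n → (B ⊛ X) n S.≈ (B ⊛ Y) n
    step zero    = S.trans (B⊛-zero X) (S.sym (B⊛-zero Y))
    step (suc n) = S.trans (B⊛-suc X n) (S.trans
      (S.*-congˡ {φ} (P-B-unique {X} {Y} {Z} X-eq Y-eq n)) (S.sym (B⊛-suc Y n)))

  module _
    (A-zero : A 0 S.≈ S.1#)
    (A-suc : ∀ n → A (suc n) S.≈ trunc (m ℕ.* suc n) (φ S.* A n))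
    where
    open SetoidReasoning S₂.setoid

    A-unfold : A ≋ one ⊕ P (B ⊛ A)
    A-unfold zero    = S.trans A-zero (S.sym (S.trans
      (S.+-congˡ {S.1#} (≡.subst (λ N → trunc N ((B ⊛ A) 0) S.≈ S.0#) (≡.sym (ℕ.*-zeroʳ m)) (trunc-zero 0 {(B ⊛ A) 0} λ _ ())))
      (S.+-identityʳ S.1#)))
    A-unfold (suc n) = S.trans (A-suc n) (S.sym (S.trans (S.+-identityˡ _)
      (trunc-cong (m ℕ.* suc n) (B⊛-suc A n))))

    -- P kills 1 and is idempotent. This makes the inhomogeneous term of the equation for `D A`
    -- agree with that for `T ⊛ A`.
    P-BA : P (B ⊛ A) ≋ P A
    P-BA = S₂.sym (begin
      P A                        ≈⟨ P-cong A-unfold ⟩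
      P (one ⊕ P (B ⊛ A))        ≈⟨ P-⊕ one (P (B ⊛ A)) ⟩
      P one ⊕ P (P (B ⊛ A))      ≈⟨ S₂.+-cong P-one (λ n → trunc-idem (m ℕ.* n) ((B ⊛ A) n)) ⟩
      S₂.0# ⊕ P (B ⊛ A)          ≈⟨ S₂.+-identityˡ _ ⟩
      P (B ⊛ A)                  ∎)

    -- Apply D to `A-unfold`: it kills 1, commutes with P, and fixes `B`, which is homogeneous of
    -- degree 1 in x.
    DA-fixpoint : D A ≋ P (B ⊛ D A) ⊕ P A
    DA-fixpoint = begin
      D A                              ≈⟨ D-cong A-unfold ⟩
      D (one ⊕ P (B ⊛ A))              ≈⟨ (λ n → S.distribˡ (natK seriesRing n) (one n) (P (B ⊛ A) n)) ⟩
      D one ⊕ D (P (B ⊛ A))            ≈⟨ S₂.+-cong D-one (D-P (B ⊛ A)) ⟩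
      S₂.0# ⊕ P (D (B ⊛ A))            ≈⟨ S₂.+-identityˡ _ ⟩
      P (D (B ⊛ A))                    ≈⟨ P-cong (D-⊛ B A) ⟩
      P ((D B ⊛ A) ⊕ (B ⊛ D A))        ≈⟨ P-⊕ (D B ⊛ A) (B ⊛ D A) ⟩
      P (D B ⊛ A) ⊕ P (B ⊛ D A)        ≈⟨ S₂.+-congʳ (P-cong (S₂.*-congʳ {A} D-B)) ⟩
      P (B ⊛ A) ⊕ P (B ⊛ D A)          ≈⟨ S₂.+-comm (P (B ⊛ A)) _ ⟩
      P (B ⊛ D A) ⊕ P (B ⊛ A)          ≈⟨ S₂.+-congˡ {P (B ⊛ D A)} P-BA ⟩
      P (B ⊛ D A) ⊕ P A                ∎

    TA-fixpoint : T ⊛ A ≋ P (B ⊛ (T ⊛ A)) ⊕ P A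
    TA-fixpoint = RotaBaxter.PΦA-fixpoint seriesRing₂ P P-cong P-⊕ P-RotaBaxter
      {A} {B} {Φ} A-unfold Φ-unfold

    spitzer : D A ≋ T ⊛ A
    spitzer = P-B-unique {Z = P A} DA-fixpoint TA-fixpoint

-- Lattice paths

-- The d-th second-row letter (from the largest label) may follow e first-row
-- letters: it sits in column mn − d + 1, which has no wall exactly when m ∣ d.
Allowed : ℕ → ℕ → ℕ → Set
Allowed m e d = m ∣ d → e < d

allowed? : ∀ m e d → Dec (Allowed m e d)
allowed? m e d = (m ∣? d) →-dec (e ℕ.<? d)

countIf : ∀ {P : Set} → Dec P → ℕ → ℕ
countIf (yes _) n = n
countIf (no  _) n = 0

countIf-yes : ∀ {P : Set} (P? : Dec P) {n} → P → countIf P? n ≡ n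
countIf-yes (yes _) p = ≡.refl
countIf-yes (no ¬p) p = contradiction p ¬p

countIf-no : ∀ {P : Set} (P? : Dec P) {n} → ¬ P → countIf P? n ≡ 0
countIf-no (yes p) ¬p = contradiction p ¬p
countIf-no (no _)  ¬p = ≡.refl

-- Words with d second-row and e first-row letters: all of them (pathCount), and
-- those ending in a second-row letter or empty (endsInD).
mutual
  endsInD : ℕ → ℕ → ℕ → ℕ
  endsInD m zero    zero    = 1
  endsInD m zero    (suc e) = 0
  endsInD m (suc d) e       = countIf (allowed? m e (suc d)) (pathCount m d e)

  pathCount : ℕ → ℕ → ℕ → ℕ
  pathCount m d e = sumTo ℕ._+_ 0 e (endsInD m d)

-- The coefficients of x d/dx applied to the exponent of the exponential formula. At 0 the general
-- clause would give `0 C 0`, which is 1 instead of 0.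
pathCoeff : ℕ → ℕ → ℕ
pathCoeff m zero        = 0
pathCoeff m n@(suc _)   = (2 ℕ.* m ℕ.* n ∸ 1) C (m ℕ.* n ∸ 1)

∤-between-multiples : ∀ m n i → suc i < m → ¬ (m ∣ suc i ℕ.+ m ℕ.* n)
∤-between-multiples m n i i<m m∣ = ℕ.<⇒≱ i<m (∣⇒≤
  (∣m+n∣m⇒∣n (≡.subst (m ∣_) (ℕ.+-comm (suc i) (m ℕ.* n)) m∣) (m∣m*n n)))

-- The summands are the coefficients of 1/(1 - z)^(r+1), and taking partial sums multiplies by 1/(1
-- - z).
hockeyStick : ∀ r e → sumTo ℕ._+_ 0 e (λ i → (i ℕ.+ r) C i) ≡ (e ℕ.+ suc r) C e
hockeyStick r zero    = ≡.refl
hockeyStick r (suc e) = begin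
  sumTo ℕ._+_ 0 e (λ i → (i ℕ.+ r) C i) ℕ.+ (suc e ℕ.+ r) C suc e
    ≡⟨ ≡.cong₂ ℕ._+_ (hockeyStick r e) (≡.cong (_C suc e) (≡.sym (ℕ.+-suc e r))) ⟩
  (e ℕ.+ suc r) C e ℕ.+ (e ℕ.+ suc r) C suc e
    ≡⟨ nCk+nC[k+1]≡[n+1]C[k+1] (e ℕ.+ suc r) e ⟩
  (suc e ℕ.+ suc r) C suc e ∎
  where open ≡.≡-Reasoning

-- Walks as series in z, and their evaluation at z = 1

module Evaluation (K : CommutativeRing 0ℓ 0ℓ) where
  open CommutativeRing K
  open SetoidReasoning setoid
  open PowerSeries K
  private
    module S = CommutativeRing seriesRing
    module PS₂ = PowerSeries seriesRing

  natK-sumTo : ∀ n f → natK K (sumTo ℕ._+_ 0 n f) ≈ ∑ n (λ k → natK K (f k))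
  natK-sumTo zero    f = sym (+-identityˡ _)
  natK-sumTo (suc n) f = trans (natK-+ (sumTo ℕ._+_ 0 n f) (f (suc n))) (+-congʳ (natK-sumTo n f))

  ones : ℕ → Carrier
  ones _ = 1#

  ⊛-ones : ∀ f n → (f ⊛ ones) n ≈ ∑ n f
  ⊛-ones f n = ∑-cong n λ k _ → *-identityʳ (f k)

  natK-series-* : ∀ n f → natK seriesRing n S.* f ≋ (λ e → natK K n * f e)
  natK-series-* zero    f e = trans (S.zeroˡ f e) (sym (zeroˡ _))
  natK-series-* (suc n) f e = begin
    (natK seriesRing (suc n) S.* f) e       ≈⟨ S.distribʳ f S.1# (natK seriesRing n) e ⟩
    (S.1# S.* f) e + (natK seriesRing n S.* f) e
      ≈⟨ +-cong (trans (S.*-identityˡ f e) (sym (*-identityˡ _))) (natK-series-* n f e) ⟩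
    1# * f e + natK K n * f e               ≈⟨ distribʳ _ _ _ ⟨
    natK K (suc n) * f e                    ∎

  ∑-∑-swap : ∀ M n F → ∑ M (PS₂.∑ n F) ≈ ∑ n (λ k → ∑ M (F k))
  ∑-∑-swap M zero    F = trans (∑-+ M (λ _ → 0#) (F 0)) (+-congʳ (∑-zero M λ _ _ → refl))
  ∑-∑-swap M (suc n) F = trans (∑-+ M (PS₂.∑ n F) (F (suc n))) (+-congʳ (∑-∑-swap M n F))

  -- Multiplicativity of evaluation at z = 1 for polynomials of degree at most M and L. A partial
  -- sum is a coefficient of the product with `ones`, so the proof is associativity followed by
  -- discarding the vanishing ranges.
  ∑-⊛ : ∀ M L {a b} → (∀ i → M < i → a i ≈ 0#) → (∀ i → L < i → b i ≈ 0#) →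
    ∑ (M ℕ.+ L) (a ⊛ b) ≈ ∑ M a * ∑ L b
  ∑-⊛ M L {a} {b} a≈0 b≈0 = begin
    ∑ (M ℕ.+ L) (a ⊛ b)                                   ≈⟨ ⊛-ones (a ⊛ b) (M ℕ.+ L) ⟨
    ((a ⊛ b) ⊛ ones) (M ℕ.+ L)                            ≈⟨ ⊛-assoc a b ones (M ℕ.+ L) ⟩
    ∑ (M ℕ.+ L) (λ i → a i * (b ⊛ ones) (M ℕ.+ L ∸ i))    ≡⟨ ≡.cong (λ N → ∑ N (λ i → a i * (b ⊛ ones) (M ℕ.+ L ∸ i))) (ℕ.+-comm M L) ⟩
    ∑ (L ℕ.+ M) (λ i → a i * (b ⊛ ones) (M ℕ.+ L ∸ i))    ≈⟨ ∑-extend M L (λ i M<i → trans (*-congʳ (a≈0 i M<i)) (zeroˡ _)) ⟩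
    ∑ M (λ i → a i * (b ⊛ ones) (M ℕ.+ L ∸ i))            ≈⟨ ∑-cong M (λ i i≤M → *-congˡ (tail i i≤M)) ⟩
    ∑ M (λ i → a i * ∑ L b)                               ≈⟨ *-distribʳ-∑ M _ a ⟨
    ∑ M a * ∑ L b                                         ∎
    where
    tail : ∀ i → i ≤ M → (b ⊛ ones) (M ℕ.+ L ∸ i) ≈ ∑ L b
    tail i i≤M = begin
      (b ⊛ ones) (M ℕ.+ L ∸ i)   ≈⟨ ⊛-ones b (M ℕ.+ L ∸ i) ⟩
      ∑ (M ℕ.+ L ∸ i) b          ≡⟨ ≡.cong (λ N → ∑ N b) (ℕ.+-∸-comm L i≤M) ⟩
      ∑ (M ∸ i ℕ.+ L) b          ≈⟨ ∑-extend L (M ∸ i) b≈0 ⟩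
      ∑ L b                      ∎

  ones-power : ∀ r e → powK seriesRing ones (suc r) e ≈ natK K ((e ℕ.+ r) C e)
  ones-power zero    e = begin
    (ones ⊛ one) e              ≈⟨ S.*-identityʳ ones e ⟩
    1#                          ≈⟨ +-identityʳ 1# ⟨
    natK K 1                    ≡⟨ ≡.cong (natK K) (≡.trans (≡.cong (_C e) (ℕ.+-identityʳ e)) (nCn≡1 e)) ⟨
    natK K ((e ℕ.+ 0) C e)      ∎
  ones-power (suc r) e = begin
    (ones ⊛ powK seriesRing ones (suc r)) e           ≈⟨ ⊛-comm ones (powK seriesRing ones (suc r)) e ⟩
    (powK seriesRing ones (suc r) ⊛ ones) e           ≈⟨ ⊛-ones (powK seriesRing ones (suc r)) e ⟩
    ∑ e (powK seriesRing ones (suc r))                ≈⟨ ∑-cong e (λ i _ → ones-power r i) ⟩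
    ∑ e (λ i → natK K ((i ℕ.+ r) C i))                ≈⟨ natK-sumTo e (λ i → (i ℕ.+ r) C i) ⟨
    natK K (sumTo ℕ._+_ 0 e (λ i → (i ℕ.+ r) C i))    ≡⟨ ≡.cong (natK K) (hockeyStick r e) ⟩
    natK K ((e ℕ.+ suc r) C e)                        ∎

  -- The sum up to degree M is the z^M coefficient of 1/(1 - z)^(M+2). With M + 1 = mk this becomes
  -- C(2mk-1, mk-1).
  ∑-trunc-ones-power : ∀ M → ∑ (suc M) (trunc (suc M) (powK seriesRing ones (suc M)))
    ≈ natK K ((M ℕ.+ suc M) C M)
  ∑-trunc-ones-power M = begin
    ∑ M (trunc (suc M) h) + trunc (suc M) h (suc M) ≈⟨ +-cong (∑-cong M λ k k≤M → trunc-< h (s≤s k≤M)) (trunc-≥ h (ℕ.≤-refl {suc M})) ⟩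
    ∑ M h + 0#                                      ≈⟨ +-identityʳ _ ⟩
    ∑ M h                                           ≈⟨ ⊛-ones h M ⟨
    (h ⊛ ones) M                                    ≈⟨ ⊛-comm h ones M ⟩
    powK seriesRing ones (suc (suc M)) M            ≈⟨ ones-power (suc M) M ⟩
    natK K ((M ℕ.+ suc M) C M)                      ∎
    where h = powK seriesRing ones (suc M)

  module _ (m′ : ℕ) where
    private
      m = suc m′

    G : ℕ → ℕ → Carrier
    G d e = natK K (endsInD m d e)

    G⊛ones : ∀ d e → (G d ⊛ ones) e ≈ natK K (pathCount m d e)
    G⊛ones d e = trans (⊛-ones (G d) e) (sym (natK-sumTo e (endsInD m d)))

    G-zero : G 0 ≋ one
    G-zero zero    = +-identityʳ 1#
    G-zero (suc e) = refl

    -- Any number of first-row letters may precede the new second-row letter, which multiplies by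
    -- 1/(1 - z), the series `ones`.
    G-suc-∤ : ∀ d → ¬ (m ∣ suc d) → G (suc d) ≋ ones ⊛ G d
    G-suc-∤ d m∤ e rewrite countIf-yes (allowed? m e (suc d)) {pathCount m d e} (λ m∣ → contradiction m∣ m∤) =
      trans (sym (G⊛ones d e)) (⊛-comm (G d) ones e)

    G-suc-∣ : ∀ d → m ∣ suc d → G (suc d) ≋ trunc (suc d) (ones ⊛ G d)
    G-suc-∣ d m∣ e with ℕ.<-≤-connex e (suc d)
    ... | inj₁ e<d rewrite countIf-yes (allowed? m e (suc d)) {pathCount m d e} (λ _ → e<d) =
      trans (trans (sym (G⊛ones d e)) (⊛-comm (G d) ones e)) (sym (trunc-< (ones ⊛ G d) e<d))
    ... | inj₂ d≤e rewrite countIf-no (allowed? m e (suc d)) {pathCount m d e} (λ ok → ℕ.<⇒≱ (ok m∣) d≤e) =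
      sym (trunc-≥ (ones ⊛ G d) d≤e)

    G-block : ∀ n i → i < m → G (i ℕ.+ m ℕ.* n) ≋ powK seriesRing ones i ⊛ G (m ℕ.* n)
    G-block n zero    _    = S.sym (S.*-identityˡ (G (m ℕ.* n)))
    G-block n (suc i) i<m  = S.trans (G-suc-∤ (i ℕ.+ m ℕ.* n) (∤-between-multiples m n i i<m))
      (S.trans (S.*-congˡ {ones} (G-block n i (ℕ.<-trans (ℕ.n<1+n i) i<m)))
        (S.sym (S.*-assoc ones (powK seriesRing ones i) (G (m ℕ.* n)))))

    A : ℕ → ℕ → Carrier
    A n = G (m ℕ.* n)

    φ : ℕ → Carrier
    φ = powK seriesRing ones m

    A-zero : A 0 ≋ one
    A-zero rewrite ℕ.*-zeroʳ m′ = G-zero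

    -- In a block of m second-row letters only the last is constrained: m factors 1/(1 - z) form φ,
    -- and a single cut follows.
    A-suc : ∀ n → A (suc n) ≋ trunc (m ℕ.* suc n) (φ ⊛ A n)
    A-suc n = ≡.subst (λ M → G M ≋ trunc M (φ ⊛ A n)) (≡.sym (ℕ.*-suc m n)) (S.trans
      (G-suc-∣ (m′ ℕ.+ m ℕ.* n) (∣m∣n⇒∣m+n ∣-refl (m∣m*n n)))
      (trunc-cong (m ℕ.+ m ℕ.* n) (S.trans
        (S.*-congˡ {ones} (G-block n m′ (ℕ.n<1+n m′)))
        (S.sym (S.*-assoc ones (powK seriesRing ones m′) (A n))))))

    open SpitzerIdentity K m φ A using (T; spitzer)

    A-support : ∀ n i → m ℕ.* n < i → A n i ≈ 0#
    A-support zero    (suc i) _    = A-zero (suc i)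
    A-support (suc n) i       mn<i = trans (A-suc n i) (trunc-≥ (φ ⊛ A n) (ℕ.<⇒≤ mn<i))

    ∑-T : ∀ k → ∑ (m ℕ.* k) (T k) ≈ natK K (pathCoeff m k)
    ∑-T zero    rewrite ℕ.*-zeroʳ m′ = +-identityˡ 0#
    ∑-T (suc k) = begin
      ∑ M (trunc M (powK seriesRing φ (suc k)))
        ≈⟨ ∑-cong M (λ i _ → trunc-cong M (S.sym (PS₂.powK-* ones m (suc k))) i) ⟩
      ∑ M (trunc M (powK seriesRing ones M))
        ≈⟨ ∑-trunc-ones-power M′ ⟩
      natK K ((M′ ℕ.+ M) C M′)
        ≡⟨ ≡.cong (λ j → natK K ((j ∸ 1) C M′)) 2M ⟨
      natK K (pathCoeff m (suc k)) ∎
      where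
      M = m ℕ.* suc k
      M′ = M ∸ 1
      2M : 2 ℕ.* m ℕ.* suc k ≡ M ℕ.+ M
      2M = ≡.trans (ℕ.*-assoc 2 m (suc k)) (≡.cong (M ℕ.+_) (ℕ.+-identityʳ M))

    -- Spitzer's identity evaluated at z = 1. The ring is arbitrary, because the result is used both
    -- over the field containing the roots of unity and over the rationals.
    pathCount-recurrence : ∀ n → let f = λ n → pathCount m (m ℕ.* n) (m ℕ.* n) in
      natK K n * natK K (f n) ≈ ∑ n (λ k → natK K (pathCoeff m k) * natK K (f (n ∸ k)))
    pathCount-recurrence n = begin
      natK K n * natK K (f n)
        ≈⟨ *-congˡ (∑-A n) ⟨
      natK K n * ∑ N (A n)
        ≈⟨ *-distribˡ-∑ N _ _ ⟩
      ∑ N (λ e → natK K n * A n e)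
        ≈⟨ ∑-cong N (λ e _ → natK-series-* n (A n) e) ⟨
      ∑ N (natK seriesRing n S.* A n)
        ≈⟨ ∑-cong N (λ e _ → spitzer A-zero A-suc n e) ⟩
      ∑ N (PS₂.∑ n (λ k → T k S.* A (n ∸ k)))
        ≈⟨ ∑-∑-swap N n (λ k → T k S.* A (n ∸ k)) ⟩
      ∑ n (λ k → ∑ N (T k ⊛ A (n ∸ k)))
        ≈⟨ ∑-cong n term ⟩
      ∑ n (λ k → natK K (pathCoeff m k) * natK K (f (n ∸ k))) ∎
      where
      f = λ n → pathCount m (m ℕ.* n) (m ℕ.* n)
      N = m ℕ.* n
      ∑-A : ∀ n → ∑ (m ℕ.* n) (A n) ≈ natK K (f n)
      ∑-A n = sym (natK-sumTo (m ℕ.* n) (endsInD m (m ℕ.* n)))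
      term : ∀ k → k ≤ n →
        ∑ N (T k ⊛ A (n ∸ k)) ≈ natK K (pathCoeff m k) * natK K (f (n ∸ k))
      term k k≤n = begin
        ∑ N (T k ⊛ A (n ∸ k))
          ≡⟨ ≡.cong (λ M → ∑ M (T k ⊛ A (n ∸ k))) (≡.trans (≡.cong (m ℕ.*_) (≡.sym (ℕ.m+[n∸m]≡n k≤n))) (ℕ.*-distribˡ-+ m k (n ∸ k))) ⟩
        ∑ (m ℕ.* k ℕ.+ m ℕ.* (n ∸ k)) (T k ⊛ A (n ∸ k))
          ≈⟨ ∑-⊛ (m ℕ.* k) (m ℕ.* (n ∸ k)) (λ i mk<i → trunc-≥ (powK seriesRing φ k) (ℕ.<⇒≤ mk<i)) (A-support (n ∸ k)) ⟩
        ∑ (m ℕ.* k) (T k) * ∑ (m ℕ.* (n ∸ k)) (A (n ∸ k))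
          ≈⟨ *-cong (∑-T k) (∑-A (n ∸ k)) ⟩
        natK K (pathCoeff m k) * natK K (f (n ∸ k)) ∎

-- Catalan numbers as ballot numbers

-- n C (k − 1), with value 0 at k = 0
infix 8 _C⁻_
_C⁻_ : ℕ → ℕ → ℕ
n C⁻ zero  = 0
n C⁻ suc k = n C k

pascal⁻ : ∀ n k → n C⁻ k ℕ.+ n C k ≡ suc n C k
pascal⁻ n zero    = ≡.refl
pascal⁻ n (suc k) = nCk+nC[k+1]≡[n+1]C[k+1] n k

absorption : ∀ n k → suc k ℕ.* (suc n C suc k) ≡ suc n ℕ.* (n C k)
absorption zero    zero    = ≡.refl
absorption zero    (suc k) = ℕ.*-zeroʳ k
absorption (suc n) zero    = ≡.trans (ℕ.*-identityˡ _) (≡.trans (≡.sym (nCk+nC[k+1]≡[n+1]C[k+1] (suc n) 0))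
  (≡.cong suc (≡.trans (≡.sym (ℕ.*-identityˡ _)) (absorption n 0))))
absorption (suc n) (suc k) = begin
  suc (suc k) ℕ.* (suc (suc n) C suc (suc k))
    ≡⟨ ≡.cong (suc (suc k) ℕ.*_) (nCk+nC[k+1]≡[n+1]C[k+1] (suc n) (suc k)) ⟨
  suc (suc k) ℕ.* (X ℕ.+ suc n C suc (suc k))
    ≡⟨ ℕ.*-distribˡ-+ (suc (suc k)) X _ ⟩
  (X ℕ.+ suc k ℕ.* X) ℕ.+ suc (suc k) ℕ.* (suc n C suc (suc k))
    ≡⟨ ≡.cong₂ (λ p q → (X ℕ.+ p) ℕ.+ q) (absorption n k) (absorption n (suc k)) ⟩
  (X ℕ.+ suc n ℕ.* (n C k)) ℕ.+ suc n ℕ.* (n C suc k)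
    ≡⟨ ≡.trans (ℕ.+-assoc X _ _) (≡.cong (X ℕ.+_) (≡.sym (ℕ.*-distribˡ-+ (suc n) (n C k) _))) ⟩
  X ℕ.+ suc n ℕ.* (n C k ℕ.+ n C suc k)
    ≡⟨ ≡.cong (λ y → X ℕ.+ suc n ℕ.* y) (nCk+nC[k+1]≡[n+1]C[k+1] n k) ⟩
  suc (suc n) ℕ.* X ∎
  where
  open ≡.≡-Reasoning
  X = suc n C suc k

central-symmetry : ∀ d → suc (d ℕ.+ d) C suc d ≡ suc (d ℕ.+ d) C d
central-symmetry d = ≡.trans (nCk≡nC[n∸k] (s≤s (ℕ.m≤m+n d d)))
  (≡.cong (suc (d ℕ.+ d) C_) (ℕ.m+n∸m≡n d d))

pathCount-0 : ∀ d → pathCount 1 d 0 ≡ 1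
pathCount-0 zero    = ≡.refl
pathCount-0 (suc d) rewrite countIf-yes (allowed? 1 0 (suc d)) {pathCount 1 d 0} (λ _ → s≤s z≤n) = pathCount-0 d

-- The ballot formula C(d+e, e) - C(d+e, e-1), with the subtracted term moved across. Away from the
-- diagonal both sides obey Pascal's rule.
pathCount-ballot : ∀ d e → e ≤ d → pathCount 1 d e ℕ.+ (d ℕ.+ e) C⁻ e ≡ (d ℕ.+ e) C e
pathCount-ballot d       zero    _ = ≡.trans (ℕ.+-identityʳ _) (pathCount-0 d)
pathCount-ballot (suc d) (suc e) (s≤s e≤d) = begin
  (pathCount 1 (suc d) e ℕ.+ endsInD 1 (suc d) (suc e)) ℕ.+ suc n C⁻ suc e
    ≡⟨ ≡.cong ((pathCount 1 (suc d) e ℕ.+ endsInD 1 (suc d) (suc e)) ℕ.+_) (pascal⁻ n e) ⟨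
  (pathCount 1 (suc d) e ℕ.+ endsInD 1 (suc d) (suc e)) ℕ.+ (n C⁻ e ℕ.+ n C e)
    ≡⟨ solve 4 (λ a b c d → (a :+ b) :+ (c :+ d) := (a :+ c) :+ (b :+ d)) ≡.refl
         (pathCount 1 (suc d) e) (endsInD 1 (suc d) (suc e)) (n C⁻ e) (n C e) ⟩
  (pathCount 1 (suc d) e ℕ.+ n C⁻ e) ℕ.+ (endsInD 1 (suc d) (suc e) ℕ.+ n C e)
    ≡⟨ ≡.cong₂ ℕ._+_ (left (pathCount-ballot (suc d) e (ℕ.m≤n⇒m≤1+n e≤d))) (right (pathCount-ballot d (suc e))) ⟩
  n C e ℕ.+ n C suc e
    ≡⟨ nCk+nC[k+1]≡[n+1]C[k+1] n e ⟩
  suc n C suc e ∎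
  where
  open ≡.≡-Reasoning
  open +-*-Solver
  n = d ℕ.+ suc e
  left : pathCount 1 (suc d) e ℕ.+ (suc d ℕ.+ e) C⁻ e ≡ (suc d ℕ.+ e) C e →
    pathCount 1 (suc d) e ℕ.+ n C⁻ e ≡ n C e
  left = ≡.subst (λ j → pathCount 1 (suc d) e ℕ.+ j C⁻ e ≡ j C e) (≡.sym (ℕ.+-suc d e))
  right : (suc e ≤ d → pathCount 1 d (suc e) ℕ.+ n C e ≡ n C suc e) →
    endsInD 1 (suc d) (suc e) ℕ.+ n C e ≡ n C suc e
  right ih with ℕ.m≤n⇒m<n∨m≡n e≤d
  ... | inj₁ e<d rewrite countIf-yes (allowed? 1 (suc e) (suc d)) {pathCount 1 d (suc e)} (λ _ → s≤s e<d) = ih e<d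
  -- On the diagonal the letter is forbidden, and the two middle binomials of an odd row agree.
  ... | inj₂ ≡.refl rewrite countIf-no (allowed? 1 (suc e) (suc e)) {pathCount 1 e (suc e)} (λ ok → ℕ.<-irrefl ≡.refl (ok (1∣ suc e))) =
    ≡.subst (λ j → j C e ≡ j C suc e) (≡.sym (ℕ.+-suc e e)) (≡.sym (central-symmetry e))

-- After adding n C(2n, n-1), both sides equal n C(2n+1, n): the left by absorption, the right by
-- Pascal's rule.
sucn*C⁻ : ∀ n → suc n ℕ.* (n ℕ.+ n) C⁻ n ≡ n ℕ.* ((n ℕ.+ n) C n)
sucn*C⁻ zero       = ≡.refl
sucn*C⁻ n@(suc n′) = ℕ.+-cancelʳ-≡ (n ℕ.* L) _ _ (begin
  suc n ℕ.* L ℕ.+ n ℕ.* L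
    ≡⟨ solve 2 (λ n l → (con 1 :+ n) :* l :+ n :* l := (con 1 :+ (n :+ n)) :* l) ≡.refl n L ⟩
  suc (n ℕ.+ n) ℕ.* L
    ≡⟨ absorption (n ℕ.+ n) n′ ⟨
  n ℕ.* (suc (n ℕ.+ n) C n)
    ≡⟨ ≡.cong (n ℕ.*_) (nCk+nC[k+1]≡[n+1]C[k+1] (n ℕ.+ n) n′) ⟨
  n ℕ.* (L ℕ.+ (n ℕ.+ n) C n)
    ≡⟨ ≡.trans (ℕ.*-distribˡ-+ n L _) (ℕ.+-comm (n ℕ.* L) _) ⟩
  n ℕ.* ((n ℕ.+ n) C n) ℕ.+ n ℕ.* L ∎)
  where
  open ≡.≡-Reasoning
  open +-*-Solver
  L = (n ℕ.+ n) C n′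

-- The division in `catalan` has to be shown exact: n + 1 times the ballot formula reads (n+1)X + nY
-- = (n+1)Y, whence (n+1)X = Y.
pathCount-catalan : ∀ n → pathCount 1 n n ≡ catalan n
pathCount-catalan n = ≡.sym (begin
  catalan n                   ≡⟨ ≡.cong (λ j → ((n ℕ.+ j) C n) div suc n) (ℕ.+-identityʳ n) ⟩
  ((n ℕ.+ n) C n) div suc n   ≡⟨ ≡.cong (_div suc n) exact ⟨
  (X ℕ.* suc n) div suc n     ≡⟨ m*n/n≡m X (suc n) ⟩
  X                           ∎)
  where
  open ≡.≡-Reasoning
  X = pathCount 1 n n
  Y = (n ℕ.+ n) C n
  exact : X ℕ.* suc n ≡ Y
  exact = ℕ.+-cancelʳ-≡ (n ℕ.* Y) _ _ (begin
    X ℕ.* suc n ℕ.+ n ℕ.* Y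
      ≡⟨ ≡.cong₂ ℕ._+_ (ℕ.*-comm X (suc n)) (≡.sym (sucn*C⁻ n)) ⟩
    suc n ℕ.* X ℕ.+ suc n ℕ.* (n ℕ.+ n) C⁻ n
      ≡⟨ ℕ.*-distribˡ-+ (suc n) X _ ⟨
    suc n ℕ.* (X ℕ.+ (n ℕ.+ n) C⁻ n)
      ≡⟨ ≡.cong (suc n ℕ.*_) (pathCount-ballot n n ℕ.≤-refl) ⟩
    Y ℕ.+ n ℕ.* Y ∎)

-- Tableaux as lattice paths

-- One pigeonhole step: a used partner is removed, and a match of any predicate disjoint from `P`
-- sits elsewhere and survives.
delete : ∀ {B : Set} {P : B → Set} {ys} → Any P ys → ∃[ ys′ ] (length ys ≡ suc (length ys′) ×
  ∀ {Q : B → Set} → (∀ y → P y → ¬ Q y) → Any Q ys → Any Q ys′)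
delete {ys = y ∷ ys} (here py) = ys , ≡.refl , λ where
  P∩Q (here qy)   → contradiction qy (P∩Q y py)
  P∩Q (there any) → any
delete {ys = y ∷ ys} (there p) with delete p
... | ys′ , eq , keep = y ∷ ys′ , ≡.cong suc eq , λ where
  P∩Q (here qy)   → here qy
  P∩Q (there any) → there (keep P∩Q any)

-- Injections are given by a relation because fillings are functions: without function
-- extensionality, a filling built from a path need not be propositionally equal to its copy in
-- `allFillings`.
length-≤-via : ∀ {A B : Set} (R : A → B → Set) {xs ys} →
  AllPairs (λ x x′ → ∀ y → R x y → ¬ R x′ y) xs →
  All (λ x → Any (R x) ys) xs → length xs ≤ length ys
length-≤-via R []               []             = z≤n
length-≤-via R (apart ∷ aparts) (match ∷ matches) with delete match
... | ys′ , eq , keep = ≡.subst (_ ≤_) (≡.sym eq) (s≤s (length-≤-via R aparts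
  (All.zipWith (λ (x-apart , any) → keep x-apart any) (apart , matches))))

Any-filter⁺ : ∀ {A : Set} {P Q : A → Set} (Q? : Decidable Q) → (∀ {x} → P x → Q x) →
  ∀ {xs} → Any P xs → Any P (filter Q? xs)
Any-filter⁺ Q? P⊆Q any with find any
... | _ , x∈xs , px = lose (∈-filter⁺ Q? x∈xs (P⊆Q px)) px

module _ {A : Set} (_~_ : A → A → Set) where

  -- The relation is a parameter since `allFillings` nests `allFuns`: the inner level compares
  -- labels by equality, the outer one compares rows pointwise.
  allFuns-apart : ∀ n {xs} → AllPairs (λ x y → ¬ (x ~ y)) xs →
    AllPairs (λ f g → ¬ (∀ i → f i ~ g i)) (allFuns n xs)
  allFuns-apart zero         _     = [] ∷ []
  allFuns-apart (suc n) {xs} apart = AllPairs.concat⁺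
    (All.map⁺ (All.universal
      (λ _ → AllPairs.map⁺ (AllPairs.map (λ f≁g eq → f≁g (eq ∘ Fin.suc)) (allFuns-apart n apart))) xs))
    (AllPairs.map⁺ (AllPairs.map
      (λ a≁b → All.map⁺ (All.universal
        (λ f → All.map⁺ (All.universal (λ g eq → a≁b (eq Fin.zero)) _)) _)) apart))

  allFuns-complete : ∀ n {xs} → (∀ a → Any (a ~_) xs) →
    ∀ (f : Fin n → A) → Any (λ g → ∀ i → f i ~ g i) (allFuns n xs)
  allFuns-complete zero    _        f = here λ ()
  allFuns-complete (suc n) complete f = Any.concatMap⁺ _ (Any.map
    (λ f0~a → Any.map⁺ (Any.map
      (λ f~g → λ where
        Fin.zero    → f0~a
        (Fin.suc i) → f~g i)
      (allFuns-complete n complete (f ∘ Fin.suc))))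
    (complete (f Fin.zero)))

allFillings-apart : ∀ N → AllPairs (λ t u → ¬ (∀ r c → t r c ≡ u r c)) (allFillings N)
allFillings-apart N = allFuns-apart (λ a b → ∀ c → a c ≡ b c) 2 (allFuns-apart _≡_ N (AllPairs.tabulate⁺ λ i≢j → i≢j))

allFillings-complete : ∀ N (t : Filling N) → Any (λ u → ∀ r c → t r c ≡ u r c) (allFillings N)
allFillings-complete N = allFuns-complete (λ a b → ∀ c → a c ≡ b c) 2 (allFuns-complete _≡_ N (λ a → Any.tabulate⁺ a ≡.refl))

-- The least remaining label can only be at the head of its row, which is what lets `toPath` remove
-- one cell at a time.
starts-at : ∀ {e s} (a : Fin (suc e) → ℕ) → (∀ i → s ≤ a i) →
  (∀ i j → i Fin.< j → a i < a j) → ∀ i → a i ≡ s → a Fin.zero ≡ s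
starts-at a a-≥ a-mono Fin.zero    eq = eq
starts-at a a-≥ a-mono (Fin.suc i) eq = contradiction (a-≥ Fin.zero)
  (ℕ.<⇒≱ (≡.subst (a Fin.zero <_) eq (a-mono Fin.zero (Fin.suc i) (s≤s z≤n))))

module _ (m : ℕ) where

  -- A path lists the rows of the labels s, s+1, … (up: first row, down: second
  -- row) of the last e first-row and the last d second-row cells.
  data Path : ℕ → ℕ → Set where
    nil  : Path 0 0
    up   : ∀ {e d} → Path e d → Path (suc e) d
    down : ∀ {e d} → .(Allowed m e (suc d)) → Path e d → Path e (suc d)

  downs : ∀ {e d} → List (Path e d) → List (Path e (suc d))
  downs {e} {d} ps with allowed? m e (suc d)
  ... | yes ok = map (down ok) ps
  ... | no _   = []

  paths : ∀ e d → List (Path e d)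
  paths zero    zero    = nil ∷ []
  paths (suc e) zero    = map up (paths e zero)
  paths zero    (suc d) = downs (paths zero d)
  paths (suc e) (suc d) = map up (paths e (suc d)) ++ downs (paths (suc e) d)

  length-downs : ∀ {e d} (ps : List (Path e d)) → length ps ≡ pathCount m d e →
    length (downs ps) ≡ endsInD m (suc d) e
  length-downs {e} {d} ps eq with allowed? m e (suc d)
  ... | yes ok = ≡.trans (length-map (down ok) ps) eq
  ... | no _   = ≡.refl

  length-paths : ∀ e d → length (paths e d) ≡ pathCount m d e
  length-paths zero    zero    = ≡.refl
  length-paths (suc e) zero    = ≡.trans (length-map up (paths e zero))
    (≡.trans (length-paths e zero) (≡.sym (ℕ.+-identityʳ _)))
  length-paths zero    (suc d) = length-downs (paths zero d) (length-paths zero d)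
  length-paths (suc e) (suc d) = ≡.trans (length-++ (map up (paths e (suc d))))
    (≡.cong₂ ℕ._+_ (≡.trans (length-map up (paths e (suc d))) (length-paths e (suc d)))
                   (length-downs (paths (suc e) d) (length-paths (suc e) d)))

  ∈-downs : ∀ {e d} {p : Path e d} {ps} .(ok : Allowed m e (suc d)) → p ∈ ps → down ok p ∈ downs ps
  ∈-downs {e} {d} ok p∈ with allowed? m e (suc d)
  ... | yes _  = ∈-map⁺ (down _) p∈
  ... | no ¬ok = ⊥-elim-irr (¬ok ok)

  paths-complete : ∀ {e d} (p : Path e d) → p ∈ paths e d
  paths-complete nil = here ≡.refl
  paths-complete {d = zero}  (up p)      = ∈-map⁺ up (paths-complete p)
  paths-complete {d = suc d} (up p)      = ∈-++⁺ˡ (∈-map⁺ up (paths-complete p))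
  paths-complete {e = zero}  (down ok p) = ∈-downs ok (paths-complete p)
  paths-complete {e = suc e} (down ok p) =
    ∈-++⁺ʳ (map up (paths e _)) (∈-downs ok (paths-complete p))

  downs-unique : ∀ {e d} {ps : List (Path e d)} → Unique ps → Unique (downs ps)
  downs-unique {e} {d} ps! with allowed? m e (suc d)
  ... | yes ok = Unique.map⁺ (λ { ≡.refl → ≡.refl }) ps!
  ... | no _   = []

  up∉downs : ∀ {e d} {p : Path e (suc d)} {ps : List (Path (suc e) d)} → ¬ (up p ∈ downs ps)
  up∉downs {e} {d} up∈ with allowed? m (suc e) (suc d)
  ... | yes ok with ∈-map⁻ (down ok) up∈
  ...   | _ , _ , ()
  up∉downs {e} {d} () | no _

  paths-unique : ∀ e d → Unique (paths e d)
  paths-unique zero    zero    = [] ∷ []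
  paths-unique (suc e) zero    = Unique.map⁺ (λ { ≡.refl → ≡.refl }) (paths-unique e zero)
  paths-unique zero    (suc d) = downs-unique (paths-unique zero d)
  paths-unique (suc e) (suc d) = Unique.++⁺
    (Unique.map⁺ (λ { ≡.refl → ≡.refl }) (paths-unique e (suc d)))
    (downs-unique (paths-unique (suc e) d)) disjoint
    where
    disjoint : ∀ {p} → ¬ (p ∈ map up (paths e (suc d)) × p ∈ downs (paths (suc e) d))
    disjoint (p∈ups , p∈downs) with ∈-map⁻ up p∈ups
    ... | _ , _ , ≡.refl = up∉downs p∈downs

  row₀ : ∀ {e d} → Path e d → ℕ → Fin e → ℕ
  row₀ (up p)     s Fin.zero    = s
  row₀ (up p)     s (Fin.suc i) = row₀ p (suc s) i
  row₀ (down _ p) s i           = row₀ p (suc s) i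

  row₁ : ∀ {e d} → Path e d → ℕ → Fin d → ℕ
  row₁ (up p)     s k           = row₁ p (suc s) k
  row₁ (down _ p) s Fin.zero    = s
  row₁ (down _ p) s (Fin.suc k) = row₁ p (suc s) k

  -- The invariant for the row tails that hold the labels from s on. The tails may begin in
  -- different columns: cells i and k share a column when e - i = d - k, and `column` writes this
  -- additively.
  record Valid (e d s : ℕ) (a : Fin e → ℕ) (b : Fin d → ℕ) : Set where
    field
      a-≥    : ∀ i → s ≤ a i
      b-≥    : ∀ k → s ≤ b k
      a-mono : ∀ i j → i Fin.< j → a i < a j
      b-mono : ∀ k l → k Fin.< l → b k < b l
      a≢b    : ∀ i k → a i ≢ b k
      onto   : ∀ ℓ → s ≤ ℓ → ℓ < s ℕ.+ (e ℕ.+ d) → (∃[ i ] a i ≡ ℓ) ⊎ (∃[ k ] b k ≡ ℓ)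
      column : ∀ i k → toℕ i ℕ.+ d ≡ toℕ k ℕ.+ e → m ∣ d ∸ toℕ k → a i < b k

  rows-valid : ∀ {e d} (p : Path e d) s → Valid e d s (row₀ p s) (row₁ p s)
  rows-valid nil s = record
    { a-≥ = λ () ; b-≥ = λ () ; a-mono = λ () ; b-mono = λ () ; a≢b = λ ()
    ; onto = λ ℓ s≤ℓ ℓ<s → contradiction s≤ℓ (ℕ.<⇒≱ (≡.subst (ℓ <_) (ℕ.+-identityʳ s) ℓ<s))
    ; column = λ () }
  rows-valid {suc e} {d} (up p) s = record
    { a-≥    = λ { Fin.zero → ℕ.≤-refl ; (Fin.suc i) → ℕ.<⇒≤ (V.a-≥ i) }
    ; b-≥    = λ k → ℕ.<⇒≤ (V.b-≥ k)
    ; a-mono = λ { Fin.zero (Fin.suc j) _ → V.a-≥ j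
                 ; (Fin.suc i) (Fin.suc j) (s≤s i<j) → V.a-mono i j i<j }
    ; b-mono = V.b-mono
    ; a≢b    = λ { Fin.zero k eq → ℕ.<⇒≢ (V.b-≥ k) eq ; (Fin.suc i) k → V.a≢b i k }
    ; onto   = onto
    ; column = λ { Fin.zero k _ _ → V.b-≥ k
                 ; (Fin.suc i) k eq → V.column i k (ℕ.suc-injective (≡.trans eq (ℕ.+-suc _ e))) }
    }
    where
    module V = Valid (rows-valid p (suc s))
    onto : ∀ ℓ → s ≤ ℓ → ℓ < s ℕ.+ suc (e ℕ.+ d) →
      (∃[ i ] row₀ (up p) s i ≡ ℓ) ⊎ (∃[ k ] row₁ p (suc s) k ≡ ℓ)
    onto ℓ s≤ℓ ℓ< with ℕ.m≤n⇒m<n∨m≡n s≤ℓ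
    ... | inj₂ s≡ℓ = inj₁ (Fin.zero , s≡ℓ)
    ... | inj₁ s<ℓ with V.onto ℓ s<ℓ (≡.subst (ℓ <_) (ℕ.+-suc s _) ℓ<)
    ...   | inj₁ (i , eq) = inj₁ (Fin.suc i , eq)
    ...   | inj₂ hit      = inj₂ hit
  rows-valid {e} {suc d} (down ok p) s = record
    { a-≥    = λ i → ℕ.<⇒≤ (V.a-≥ i)
    ; b-≥    = λ { Fin.zero → ℕ.≤-refl ; (Fin.suc k) → ℕ.<⇒≤ (V.b-≥ k) }
    ; a-mono = V.a-mono
    ; b-mono = λ { Fin.zero (Fin.suc l) _ → V.b-≥ l
                 ; (Fin.suc k) (Fin.suc l) (s≤s k<l) → V.b-mono k l k<l }
    ; a≢b    = λ { i Fin.zero eq → ℕ.<⇒≢ (V.a-≥ i) (≡.sym eq) ; i (Fin.suc k) → V.a≢b i k }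
    ; onto   = onto
    -- A remaining first-row cell in the column of the new second-row cell would force `suc d ≤ e`,
    -- against `ok`.
    ; column = λ { i Fin.zero eq m∣ → ⊥-elim-irr
                     (ℕ.<⇒≱ (ok m∣) (≡.subst (suc d ≤_) eq (ℕ.m≤n+m (suc d) (toℕ i))))
                 ; i (Fin.suc k) eq → V.column i k (ℕ.suc-injective (≡.trans (≡.sym (ℕ.+-suc _ d)) eq)) }
    }
    where
    module V = Valid (rows-valid p (suc s))
    onto : ∀ ℓ → s ≤ ℓ → ℓ < s ℕ.+ (e ℕ.+ suc d) →
      (∃[ i ] row₀ p (suc s) i ≡ ℓ) ⊎ (∃[ k ] row₁ (down ok p) s k ≡ ℓ)
    onto ℓ s≤ℓ ℓ< with ℕ.m≤n⇒m<n∨m≡n s≤ℓ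
    ... | inj₂ s≡ℓ = inj₂ (Fin.zero , s≡ℓ)
    ... | inj₁ s<ℓ with V.onto ℓ s<ℓ (≡.subst (ℓ <_)
                          (≡.trans (≡.cong (s ℕ.+_) (ℕ.+-suc e d)) (ℕ.+-suc s _)) ℓ<)
    ...   | inj₁ hit      = inj₁ hit
    ...   | inj₂ (k , eq) = inj₂ (Fin.suc k , eq)

  row₀-< : ∀ {e d} (p : Path e d) s i → row₀ p s i < s ℕ.+ (e ℕ.+ d)
  row₀-< (up p)             s Fin.zero    = ℕ.m<m+n s (s≤s z≤n)
  row₀-< (up p)             s (Fin.suc i) = ≡.subst (row₀ p (suc s) i <_) (≡.sym (ℕ.+-suc s _)) (row₀-< p (suc s) i)
  row₀-< {e} {suc d} (down _ p) s i       = ≡.subst (row₀ p (suc s) i <_)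
    (≡.sym (≡.trans (≡.cong (s ℕ.+_) (ℕ.+-suc e d)) (ℕ.+-suc s _))) (row₀-< p (suc s) i)

  row₁-< : ∀ {e d} (p : Path e d) s k → row₁ p s k < s ℕ.+ (e ℕ.+ d)
  row₁-< (up p)             s k           = ≡.subst (row₁ p (suc s) k <_) (≡.sym (ℕ.+-suc s _)) (row₁-< p (suc s) k)
  row₁-< {e} {suc d} (down _ p) s Fin.zero = ℕ.m<m+n s (ℕ.m≤n⇒m≤o+n e (s≤s z≤n))
  row₁-< {e} {suc d} (down _ p) s (Fin.suc k) = ≡.subst (row₁ p (suc s) k <_)
    (≡.sym (≡.trans (≡.cong (s ℕ.+_) (ℕ.+-suc e d)) (ℕ.+-suc s _))) (row₁-< p (suc s) k)

  -- Where the letters differ, the head of the first row is s for `up` but larger than s for `down`.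
  -- Where both are `down`, the irrelevance of its side condition spares a comparison of proofs.
  rows-injective : ∀ {e d} (p q : Path e d) s →
    (∀ i → row₀ p s i ≡ row₀ q s i) → (∀ k → row₁ p s k ≡ row₁ q s k) → p ≡ q
  rows-injective nil         nil        s _   _   = ≡.refl
  rows-injective (up p)      (up q)     s eq₀ eq₁ =
    ≡.cong up (rows-injective p q (suc s) (eq₀ ∘ Fin.suc) eq₁)
  rows-injective (up p)      (down _ q) s eq₀ eq₁ =
    contradiction (eq₀ Fin.zero) (ℕ.<⇒≢ (Valid.a-≥ (rows-valid q (suc s)) Fin.zero))
  rows-injective (down _ p)  (up q)     s eq₀ eq₁ =
    contradiction (≡.sym (eq₀ Fin.zero)) (ℕ.<⇒≢ (Valid.a-≥ (rows-valid p (suc s)) Fin.zero))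
  rows-injective (down ok p) (down _ q) s eq₀ eq₁ =
    ≡.cong (down ok) (rows-injective p q (suc s) eq₀ (eq₁ ∘ Fin.suc))

  IsRowsOf : ∀ {e d} → ℕ → (Fin e → ℕ) → (Fin d → ℕ) → Path e d → Set
  IsRowsOf s a b p = (∀ i → a i ≡ row₀ p s i) × (∀ k → b k ≡ row₁ p s k)

  mutual
    -- By `onto` the label s occurs in one of the rows, and by `starts-at` at its head; that row is
    -- the next letter.
    toPath : ∀ e d s {a b} → Valid e d s a b → ∃[ p ] IsRowsOf s a b p
    toPath zero    zero    s V = nil , (λ ()) , (λ ())
    toPath (suc e) d       s V with Valid.onto V s ℕ.≤-refl (ℕ.m<m+n s (s≤s z≤n))
    ... | inj₁ (i , eq) = toPath-up e d s V
                            (starts-at _ (Valid.a-≥ V) (Valid.a-mono V) i eq)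
    toPath (suc e) (suc d) s V | inj₂ (k , eq) = toPath-down (suc e) d s V
                            (starts-at _ (Valid.b-≥ V) (Valid.b-mono V) k eq)
    toPath zero    (suc d) s V with Valid.onto V s ℕ.≤-refl (ℕ.m<m+n s (s≤s z≤n))
    ... | inj₂ (k , eq) = toPath-down zero d s V
                            (starts-at _ (Valid.b-≥ V) (Valid.b-mono V) k eq)

    toPath-up : ∀ e d s {a b} → Valid (suc e) d s a b → a Fin.zero ≡ s → ∃[ p ] IsRowsOf s a b p
    toPath-up e d s {a} {b} V a₀≡s with toPath e d (suc s) {a ∘ Fin.suc} {b} (record
      { a-≥    = λ i → ≡.subst (_< a (Fin.suc i)) a₀≡s (V.a-mono Fin.zero (Fin.suc i) (s≤s z≤n))
      ; b-≥    = λ k → ℕ.≤∧≢⇒< (V.b-≥ k) (λ s≡b → V.a≢b Fin.zero k (≡.trans a₀≡s s≡b))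
      ; a-mono = λ i j i<j → V.a-mono (Fin.suc i) (Fin.suc j) (s≤s i<j)
      ; b-mono = V.b-mono
      ; a≢b    = λ i → V.a≢b (Fin.suc i)
      ; onto   = onto
      ; column = λ i k eq → V.column (Fin.suc i) k (≡.trans (≡.cong suc eq) (≡.sym (ℕ.+-suc _ e)))
      })
      where
      module V = Valid V
      onto : ∀ ℓ → s < ℓ → ℓ < suc s ℕ.+ (e ℕ.+ d) →
        (∃[ i ] a (Fin.suc i) ≡ ℓ) ⊎ (∃[ k ] b k ≡ ℓ)
      onto ℓ s<ℓ ℓ< with V.onto ℓ (ℕ.<⇒≤ s<ℓ) (≡.subst (ℓ <_) (≡.sym (ℕ.+-suc s _)) ℓ<)
      ... | inj₁ (Fin.zero , eq)  = contradiction (≡.trans (≡.sym a₀≡s) eq) (ℕ.<⇒≢ s<ℓ)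
      ... | inj₁ (Fin.suc i , eq) = inj₁ (i , eq)
      ... | inj₂ hit              = inj₂ hit
    ... | p , eq₀ , eq₁ = up p , (λ { Fin.zero → a₀≡s ; (Fin.suc i) → eq₀ i }) , eq₁

    toPath-down : ∀ e d s {a b} → Valid e (suc d) s a b → b Fin.zero ≡ s → ∃[ p ] IsRowsOf s a b p
    toPath-down e d s {a} {b} V b₀≡s with toPath e d (suc s) {a} {b ∘ Fin.suc} (record
      { a-≥    = λ i → ℕ.≤∧≢⇒< (V.a-≥ i) (λ s≡a → V.a≢b i Fin.zero (≡.trans (≡.sym s≡a) (≡.sym b₀≡s)))
      ; b-≥    = λ k → ≡.subst (_< b (Fin.suc k)) b₀≡s (V.b-mono Fin.zero (Fin.suc k) (s≤s z≤n))
      ; a-mono = V.a-mono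
      ; b-mono = λ k l k<l → V.b-mono (Fin.suc k) (Fin.suc l) (s≤s k<l)
      ; a≢b    = λ i k → V.a≢b i (Fin.suc k)
      ; onto   = onto
      ; column = λ i k eq → V.column i (Fin.suc k) (≡.trans (ℕ.+-suc _ d) (≡.cong suc eq))
      })
      where
      module V = Valid V
      onto : ∀ ℓ → s < ℓ → ℓ < suc s ℕ.+ (e ℕ.+ d) →
        (∃[ i ] a i ≡ ℓ) ⊎ (∃[ k ] b (Fin.suc k) ≡ ℓ)
      onto ℓ s<ℓ ℓ< with V.onto ℓ (ℕ.<⇒≤ s<ℓ) (≡.subst (ℓ <_)
                           (≡.sym (≡.trans (≡.cong (s ℕ.+_) (ℕ.+-suc e d)) (ℕ.+-suc s _))) ℓ<)
      ... | inj₁ hit              = inj₁ hit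
      ... | inj₂ (Fin.zero , eq)  = contradiction (≡.trans (≡.sym b₀≡s) eq) (ℕ.<⇒≢ s<ℓ)
      ... | inj₂ (Fin.suc k , eq) = inj₂ (k , eq)
    ... | p , eq₀ , eq₁ = down ok p , eq₀ , (λ { Fin.zero → b₀≡s ; (Fin.suc k) → eq₁ k })
      where
      ok : Allowed m e (suc d)
      -- Otherwise the first-row cell at index e - (d+1) is in the same wall-free column as the cell
      -- labelled s, so its label would be below s.
      ok m∣ = ℕ.≰⇒> λ d<e →
        let i     = fromℕ< (ℕ.∸-monoʳ-< {e} {suc d} {0} (s≤s z≤n) d<e)
            i+d≡e = ≡.trans (≡.cong (ℕ._+ suc d) (Fin.toℕ-fromℕ< _)) (ℕ.m∸n+n≡m d<e)
        in ℕ.<⇒≱ (≡.subst (a i <_) b₀≡s (Valid.column V i Fin.zero i+d≡e m∣)) (Valid.a-≥ V i)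

  module _ .{{_ : NonZero m}} (n : ℕ) where
    private
      N = m ℕ.* n
      W = buildingWalls m n

    -- `buildingWalls` counts columns from the left, `Valid` from the right; modulo m the two agree
    -- because m divides N.
    no-wall⇒∣ : ∀ c → W c ≡ false → m ∣ N ∸ toℕ c
    no-wall⇒∣ c W≡false = ∣m+n∣m⇒∣n (≡.subst (m ∣_) (≡.sym (ℕ.m+[n∸m]≡n (ℕ.<⇒≤ (Fin.toℕ<n c)))) (m∣m*n n)) m∣c
      where
      m∣c : m ∣ toℕ c
      m∣c with toℕ c % m in eq
      ... | zero = m%n≡0⇒n∣m (toℕ c) m eq

    ∣⇒no-wall : ∀ c → m ∣ N ∸ toℕ c → W c ≡ false
    ∣⇒no-wall c m∣N∸c with toℕ c % m in eq
    ... | zero  = ≡.refl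
    ... | suc _ = contradiction (≡.trans (≡.sym eq) (n∣m⇒m%n≡0 (toℕ c) m m∣c)) λ ()
      where
      m∣c : m ∣ toℕ c
      m∣c = ∣m+n∣m⇒∣n (≡.subst (m ∣_) (≡.sym (ℕ.m∸n+n≡m (ℕ.<⇒≤ (Fin.toℕ<n c)))) (m∣m*n n)) m∣N∸c

    rowℕ : Filling N → Fin 2 → Fin N → ℕ
    rowℕ t r c = toℕ (t r c)

    0ᶠ 1ᶠ : Fin 2
    0ᶠ = Fin.zero
    1ᶠ = Fin.suc Fin.zero

    2N≡N+N : 2 ℕ.* N ≡ N ℕ.+ N
    2N≡N+N = ≡.cong (N ℕ.+_) (ℕ.+-identityʳ N)

    tableau⇒valid : ∀ t → IsTableau W t → Valid N N 0 (rowℕ t 0ᶠ) (rowℕ t 1ᶠ)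
    tableau⇒valid t ((injective , surjective) , rows , columns) = record
      { a-≥    = λ _ → z≤n
      ; b-≥    = λ _ → z≤n
      ; a-mono = rows 0ᶠ
      ; b-mono = rows 1ᶠ
      ; a≢b    = λ i k eq → contradiction (proj₁ (injective 0ᶠ i 1ᶠ k (Fin.toℕ-injective eq))) λ ()
      ; onto   = onto
      ; column = column
      }
      where
      onto : ∀ ℓ → 0 ≤ ℓ → ℓ < N ℕ.+ N → (∃[ i ] rowℕ t 0ᶠ i ≡ ℓ) ⊎ (∃[ k ] rowℕ t 1ᶠ k ≡ ℓ)
      onto ℓ _ ℓ< with ℓ<′ ← ≡.subst (ℓ <_) (≡.sym 2N≡N+N) ℓ< | surjective (fromℕ< ℓ<′)
      ... | Fin.zero         , c , eq = inj₁ (c , ≡.trans (≡.cong toℕ eq) (Fin.toℕ-fromℕ< ℓ<′))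
      ... | Fin.suc Fin.zero , c , eq = inj₂ (c , ≡.trans (≡.cong toℕ eq) (Fin.toℕ-fromℕ< ℓ<′))
      column : ∀ i k → toℕ i ℕ.+ N ≡ toℕ k ℕ.+ N → m ∣ N ∸ toℕ k → rowℕ t 0ᶠ i < rowℕ t 1ᶠ k
      column i k eq m∣ with Fin.toℕ-injective (ℕ.+-cancelʳ-≡ N (toℕ i) (toℕ k) eq)
      ... | ≡.refl = columns k (∣⇒no-wall k m∣)

    Codes : Filling N → Path N N → Set
    Codes t p = IsRowsOf 0 (rowℕ t 0ᶠ) (rowℕ t 1ᶠ) p

    codes⇒tableau : ∀ {t p} → Codes t p → IsTableau W t
    codes⇒tableau {t} {p} (eq₀ , eq₁) = (injective , surjective) , rows , columns
      where
      module V = Valid (rows-valid p 0)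
      mono⇒injective : ∀ {f : Fin N → ℕ} → (∀ i j → i Fin.< j → f i < f j) → ∀ {i j} → f i ≡ f j → i ≡ j
      mono⇒injective f-mono {i} {j} eq with Fin.<-cmp i j
      ... | tri< i<j _ _ = contradiction eq (ℕ.<⇒≢ (f-mono i j i<j))
      ... | tri≈ _ i≡j _ = i≡j
      ... | tri> _ _ j<i = contradiction (≡.sym eq) (ℕ.<⇒≢ (f-mono j i j<i))
      rows : RowsIncreasing t
      rows Fin.zero           c c′ c<c′ rewrite eq₀ c | eq₀ c′ = V.a-mono c c′ c<c′
      rows (Fin.suc Fin.zero) c c′ c<c′ rewrite eq₁ c | eq₁ c′ = V.b-mono c c′ c<c′
      injective : ∀ r c r′ c′ → t r c ≡ t r′ c′ → r ≡ r′ × c ≡ c′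
      injective Fin.zero           c Fin.zero           c′ eq = ≡.refl , mono⇒injective (rows 0ᶠ) (≡.cong toℕ eq)
      injective Fin.zero           c (Fin.suc Fin.zero) c′ eq = contradiction
        (≡.trans (≡.sym (eq₀ c)) (≡.trans (≡.cong toℕ eq) (eq₁ c′))) (V.a≢b c c′)
      injective (Fin.suc Fin.zero) c Fin.zero           c′ eq = contradiction
        (≡.trans (≡.sym (eq₀ c′)) (≡.trans (≡.cong toℕ (≡.sym eq)) (eq₁ c))) (V.a≢b c′ c)
      injective (Fin.suc Fin.zero) c (Fin.suc Fin.zero) c′ eq = ≡.refl , mono⇒injective (rows 1ᶠ) (≡.cong toℕ eq)
      surjective : ∀ ℓ → ∃[ r ] ∃[ c ] t r c ≡ ℓ
      surjective ℓ with V.onto (toℕ ℓ) z≤n (≡.subst (toℕ ℓ <_) 2N≡N+N (Fin.toℕ<n ℓ))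
      ... | inj₁ (c , eq) = 0ᶠ , c , Fin.toℕ-injective (≡.trans (eq₀ c) eq)
      ... | inj₂ (c , eq) = 1ᶠ , c , Fin.toℕ-injective (≡.trans (eq₁ c) eq)
      columns : ColumnsOK W t
      columns c W≡false rewrite eq₀ c | eq₁ c = V.column c c ≡.refl (no-wall⇒∣ c W≡false)

    fromPath : Path N N → Filling N
    fromPath p Fin.zero    c = fromℕ< (≡.subst (row₀ p 0 c <_) (≡.sym 2N≡N+N) (row₀-< p 0 c))
    fromPath p (Fin.suc _) c = fromℕ< (≡.subst (row₁ p 0 c <_) (≡.sym 2N≡N+N) (row₁-< p 0 c))

    fromPath-coded : ∀ p {t} → (∀ r c → fromPath p r c ≡ t r c) → Codes t p
    fromPath-coded p eq = (λ c → ≡.trans (≡.cong toℕ (≡.sym (eq 0ᶠ c))) (Fin.toℕ-fromℕ< _))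
                        , (λ c → ≡.trans (≡.cong toℕ (≡.sym (eq 1ᶠ c))) (Fin.toℕ-fromℕ< _))

    -- `Codes` matches the two lists in both directions, so each is at most as long as the other.
    numTableaux≡pathCount : numTableaux N W ≡ pathCount m N N
    numTableaux≡pathCount = ≡.trans
      (ℕ.≤-antisym
        (length-≤-via Codes
          (AllPairs.map (λ {t} {u} t≁u p t↦p u↦p → t≁u (same-code {t} {u} {p} t↦p u↦p))
            (AllPairs.filter⁺ (isTableau? W) (allFillings-apart N)))
          (All.map (λ {t} tableau → let p , t↦p = toPath N N 0 (tableau⇒valid t tableau)
                                    in lose (paths-complete p) t↦p)
            (All.all-filter (isTableau? W) (allFillings N))))
        (length-≤-via (λ p t → Codes t p)
          (AllPairs.map (λ {p} {q} p≢q t t↦p t↦q → p≢q (same-filling {p} {q} t t↦p t↦q)) (paths-unique N N))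
          (All.universal (λ p → Any-filter⁺ (isTableau? W) (λ {t} → codes⇒tableau {t} {p})
            (Any.map (fromPath-coded p) (allFillings-complete N (fromPath p)))) (paths N N))))
      (length-paths N N)
      where
      same-code : ∀ {t u p} → Codes t p → Codes u p → ∀ r c → t r c ≡ u r c
      same-code (t₀ , t₁) (u₀ , u₁) Fin.zero           c = Fin.toℕ-injective (≡.trans (t₀ c) (≡.sym (u₀ c)))
      same-code (t₀ , t₁) (u₀ , u₁) (Fin.suc Fin.zero) c = Fin.toℕ-injective (≡.trans (t₁ c) (≡.sym (u₁ c)))
      same-filling : ∀ {p q} t → Codes t p → Codes t q → p ≡ q
      same-filling {p} {q} t (p₀ , p₁) (q₀ , q₁) = rows-injective p q 0
        (λ i → ≡.trans (≡.sym (p₀ i)) (q₀ i)) (λ k → ≡.trans (≡.sym (p₁ k)) (q₁ k))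

  fbar≡pathCount : .{{_ : NonZero m}} → ∀ n → fbar m n ≡ pathCount m (m ℕ.* n) (m ℕ.* n)
  fbar≡pathCount zero    rewrite ℕ.*-zeroʳ m = ≡.refl
  fbar≡pathCount (suc n) = numTableaux≡pathCount (suc n)

-- Logarithmic derivatives

module Exponential (K : CommutativeRing 0ℓ 0ℓ) where
  open CommutativeRing K
  open PowerSeries K
  open SetoidReasoning setoid
  private
    module *-CS = CSProps *-commutativeSemigroup

  -- w k plays the role of 1/k! and G^ k that of the k-th power of G.
  module _
    (w : ℕ → Carrier) (w-suc : ∀ k → w (suc k) * natK K (suc k) ≈ w k)
    (G : ℕ → Carrier) (G₀≈0 : G 0 ≈ 0#)
    (G^ : ℕ → ℕ → Carrier)
    (G^-zero : G^ 0 ≋ one) (G^-suc : ∀ k → G^ (suc k) ≋ G ⊛ G^ k)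
    where

    D-G^ : ∀ k n → D (G^ (suc k)) n ≈ natK K (suc k) * (G^ k ⊛ D G) n
    D-G^ k n = begin
      D (G^ (suc k)) n                           ≈⟨ D-cong (G^-suc k) n ⟩
      D (G ⊛ G^ k) n                             ≈⟨ D-⊛ G (G^ k) n ⟩
      (D G ⊛ G^ k) n + (G ⊛ D (G^ k)) n          ≈⟨ +-cong (trans (⊛-comm (D G) (G^ k) n) (sym (*-identityˡ _))) (rest k) ⟩
      1# * (G^ k ⊛ D G) n + natK K k * (G^ k ⊛ D G) n ≈⟨ distribʳ _ _ _ ⟨
      natK K (suc k) * (G^ k ⊛ D G) n            ∎
      where
      D-one : D (G^ 0) ≋ (λ _ → 0#)
      D-one zero    = zeroˡ _
      D-one (suc n) = trans (*-congˡ (G^-zero (suc n))) (zeroʳ _)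
      rest : ∀ k → (G ⊛ D (G^ k)) n ≈ natK K k * (G^ k ⊛ D G) n
      rest zero    = trans (∑-zero n λ i _ → trans (*-congˡ (D-one (n ∸ i))) (zeroʳ _)) (sym (zeroˡ _))
      rest (suc k) = begin
        (G ⊛ D (G^ (suc k))) n
          ≈⟨ ∑-cong n (λ i _ → trans (*-congˡ (D-G^ k (n ∸ i))) (*-CS.x∙yz≈y∙xz _ _ _)) ⟩
        ∑ n (λ i → natK K (suc k) * (G i * (G^ k ⊛ D G) (n ∸ i)))
          ≈⟨ *-distribˡ-∑ n _ _ ⟨
        natK K (suc k) * (G ⊛ (G^ k ⊛ D G)) n
          ≈⟨ *-congˡ (⊛-assoc G (G^ k) (D G) n) ⟨
        natK K (suc k) * ((G ⊛ G^ k) ⊛ D G) n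
          ≈⟨ *-congˡ (⊛-cong {g = D G} (G^-suc k) (λ _ → refl) n) ⟨
        natK K (suc k) * (G^ (suc k) ⊛ D G) n ∎

    G^-order : ∀ k i → i < k → G^ k i ≈ 0#
    G^-order (suc k) i (s≤s i≤k) = trans (G^-suc k i) (∑-zero i λ where
      zero    _   → trans (*-congʳ G₀≈0) (zeroˡ _)
      (suc j) j<i → trans (*-congˡ (G^-order k (i ∸ suc j)
        (ℕ.<-≤-trans (ℕ.∸-monoʳ-< {i} {suc j} {0} (s≤s z≤n) j<i) i≤k))) (zeroʳ _))

    exp : ℕ → Carrier
    exp n = ∑ n (λ k → w k * G^ k n)

    D-exp : D exp ≋ exp ⊛ D G
    D-exp zero    = trans (zeroˡ _) (sym (trans (+-identityˡ _) (trans (*-congˡ (zeroˡ _)) (zeroʳ _))))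
    D-exp (suc n) = begin
      natK K (suc n) * ∑ (suc n) (λ k → w k * G^ k (suc n))
        ≈⟨ trans (*-distribˡ-∑ (suc n) _ _) (∑-cong (suc n) λ k _ → *-CS.x∙yz≈y∙xz _ _ _) ⟩
      ∑ (suc n) (λ k → w k * D (G^ k) (suc n))
        ≈⟨ ∑-head n _ ⟩
      w 0 * D (G^ 0) (suc n) + ∑ n (λ k → w (suc k) * D (G^ (suc k)) (suc n))
        ≈⟨ trans (+-congʳ (trans (*-congˡ (trans (*-congˡ (G^-zero (suc n))) (zeroʳ _))) (zeroʳ _))) (+-identityˡ _) ⟩
      ∑ n (λ k → w (suc k) * D (G^ (suc k)) (suc n))
        ≈⟨ ∑-cong n (λ k _ → trans (*-congˡ (D-G^ k (suc n))) (trans (sym (*-assoc _ _ _)) (*-congʳ (w-suc k)))) ⟩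
      ∑ n (λ k → w k * (G^ k ⊛ D G) (suc n))
        -- `D G` vanishes at 0, so only i ≤ n remain. For these the sum over k ≤ n is already all of
        -- `exp i`, since `G^ k` has no terms below degree k.
        ≈⟨ ∑-cong n (λ k _ → *-congˡ (drop-last (G^ k))) ⟩
      ∑ n (λ k → w k * ∑ n (λ i → G^ k i * D G (suc n ∸ i)))
        ≈⟨ ∑-cong n (λ k _ → trans (*-distribˡ-∑ n _ _) (∑-cong n λ i _ → sym (*-assoc _ _ _))) ⟩
      ∑ n (λ k → ∑ n (λ i → w k * G^ k i * D G (suc n ∸ i)))
        ≈⟨ ∑-swap n n _ ⟩
      ∑ n (λ i → ∑ n (λ k → w k * G^ k i * D G (suc n ∸ i)))
        ≈⟨ ∑-cong n (λ i i≤n → trans (sym (*-distribʳ-∑ n _ _)) (*-congʳ (enough i i≤n))) ⟩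
      ∑ n (λ i → exp i * D G (suc n ∸ i))
        ≈⟨ drop-last exp ⟨
      (exp ⊛ D G) (suc n) ∎
      where
      drop-last : ∀ f → (f ⊛ D G) (suc n) ≈ ∑ n (λ i → f i * D G (suc n ∸ i))
      drop-last f = trans (+-congˡ (trans (*-congˡ (trans
        (reflexive (≡.cong (D G) (ℕ.n∸n≡0 n))) (zeroˡ _))) (zeroʳ _))) (+-identityʳ _)
      enough : ∀ i → i ≤ n → ∑ n (λ k → w k * G^ k i) ≈ exp i
      enough i i≤n = trans
        (reflexive (≡.cong (λ j → ∑ j (λ k → w k * G^ k i)) (≡.sym (ℕ.m∸n+n≡m i≤n))))
        (∑-extend i (n ∸ i) λ k i<k → trans (*-congˡ (G^-order k i i<k)) (zeroʳ _))

module FieldODE (K : CommutativeRing 0ℓ 0ℓ) (isField : IsField K) (char0 : CharZero K) where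
  open CommutativeRing K
  open PowerSeries K
  open SetoidReasoning setoid

  *-cancelˡ-≉0 : ∀ {x y z} → ¬ (x ≈ 0#) → x * y ≈ x * z → y ≈ z
  *-cancelˡ-≉0 {x} {y} {z} x≉0 eq with proj₂ isField x x≉0
  ... | x⁻¹ , inv = begin
    y               ≈⟨ unit y ⟨
    x⁻¹ * (x * y)   ≈⟨ *-congˡ eq ⟩
    x⁻¹ * (x * z)   ≈⟨ unit z ⟩
    z               ∎
    where
    unit : ∀ u → x⁻¹ * (x * u) ≈ u
    unit u = trans (sym (*-assoc _ _ _)) (trans (*-congʳ (trans (*-comm _ _) inv)) (*-identityˡ u))

  -- As `h 0` vanishes, coefficient n + 1 of the product involves only coefficients up to n of the
  -- unknown, and n + 1 is invertible.
  ode-unique : ∀ {f g h} → h 0 ≈ 0# → f 0 ≈ g 0 → D f ≋ f ⊛ h → D g ≋ g ⊛ h → f ≋ g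
  ode-unique {f} {g} {h} h₀≈0 f₀≈g₀ Df Dg n = below n n ℕ.≤-refl
    where
    drop-last : ∀ f n → (f ⊛ h) (suc n) ≈ ∑ n (λ i → f i * h (suc n ∸ i))
    drop-last f n = trans (+-congˡ (trans (*-congˡ (trans
      (reflexive (≡.cong h (ℕ.n∸n≡0 n))) h₀≈0)) (zeroʳ _))) (+-identityʳ _)
    below : ∀ n k → k ≤ n → f k ≈ g k
    below zero    zero z≤n = f₀≈g₀
    below (suc n) k    k≤1+n with ℕ.m≤n⇒m<n∨m≡n k≤1+n
    ... | inj₁ (s≤s k≤n) = below n k k≤n
    ... | inj₂ ≡.refl    = *-cancelˡ-≉0 (char0 n) (begin
      D f (suc n)                          ≈⟨ trans (Df (suc n)) (drop-last f n) ⟩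
      ∑ n (λ i → f i * h (suc n ∸ i))      ≈⟨ ∑-cong n (λ i i≤n → *-congʳ (below n i i≤n)) ⟩
      ∑ n (λ i → g i * h (suc n ∸ i))      ≈⟨ trans (Dg (suc n)) (drop-last g n) ⟨
      D g (suc n)                          ∎)

  -- The sum ω + ω² + ... + ω^k, starting at exponent 1 to match the range of the Catalan product.
  geometric : Carrier → ℕ → Carrier
  geometric ω zero    = 0#
  geometric ω (suc k) = geometric ω k + powK K ω (suc k)

  geometric-telescopes : ∀ ω k → ω * geometric ω k + ω ≈ geometric ω k + powK K ω (suc k)
  geometric-telescopes ω zero    = +-cong (zeroʳ ω) (sym (*-identityʳ ω))
  geometric-telescopes ω (suc k) = begin
    ω * (geometric ω k + powK K ω (suc k)) + ω
      ≈⟨ solve 3 (λ ω g p → ω :* (g :+ p) :+ ω := (ω :* g :+ ω) :+ ω :* p) refl ω (geometric ω k) (powK K ω (suc k)) ⟩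
    (ω * geometric ω k + ω) + powK K ω (suc (suc k))
      ≈⟨ +-congʳ (geometric-telescopes ω k) ⟩
    geometric ω (suc k) + powK K ω (suc (suc k)) ∎
    where open NatSolver commutativeSemiring

  geometric-one : ∀ {ω} k → ω ≈ 1# → geometric ω k ≈ natK K k
  geometric-one zero    _    = refl
  geometric-one (suc k) ω≈1 = trans (+-comm _ _) (+-cong
    (trans (powK-cong (suc k) ω≈1) (powK-one (suc k))) (geometric-one k ω≈1))

  -- Multiplication by ω permutes the summands cyclically, so ω - 1 annihilates the sum.
  geometric-zero : ∀ {ω} m → powK K ω m ≈ 1# → ¬ (ω ≈ 1#) → geometric ω m ≈ 0#
  geometric-zero {ω} m ω^m≈1 ω≉1 = *-cancelˡ-≉0
    (λ ω-1≈0 → ω≉1 (GroupProps.x∙y⁻¹≈ε⇒x≈y +-group ω 1# ω-1≈0))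
    (begin
      (ω - 1#) * geometric ω m                     ≈⟨ distribʳ _ _ _ ⟩
      ω * geometric ω m + - 1# * geometric ω m     ≈⟨ +-cong fixed (RingProps.-1*x≈-x ring _) ⟩
      geometric ω m - geometric ω m                ≈⟨ -‿inverseʳ _ ⟩
      0#                                           ≈⟨ zeroʳ _ ⟨
      (ω - 1#) * 0#                                ∎)
    where
    fixed : ω * geometric ω m ≈ geometric ω m
    fixed = GroupProps.∙-cancelʳ +-group ω _ _ (trans (geometric-telescopes ω m)
      (+-congˡ (trans (*-congˡ ω^m≈1) (*-identityʳ ω))))

module FbarRecurrence (K : CommutativeRing 0ℓ 0ℓ) (m′ : ℕ) where
  private
    m = suc m′
  open CommutativeRing K
  open PowerSeries K
  open SetoidReasoning setoid
  open Evaluation K using (pathCount-recurrence)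

  fbar-recurrence : ∀ n → natK K n * natK K (fbar m n)
    ≈ ∑ n (λ k → natK K (pathCoeff m k) * natK K (fbar m (n ∸ k)))
  fbar-recurrence n = begin
    natK K n * natK K (fbar m n)
      ≡⟨ ≡.cong (λ c → natK K n * natK K c) (fbar≡pathCount m n) ⟩
    natK K n * natK K (pathCount m (m ℕ.* n) (m ℕ.* n))
      ≈⟨ pathCount-recurrence m′ n ⟩
    ∑ n (λ k → natK K (pathCoeff m k) * natK K (pathCount m (m ℕ.* (n ∸ k)) (m ℕ.* (n ∸ k))))
      ≈⟨ ∑-cong n (λ k _ → *-congˡ (reflexive (≡.cong (natK K) (fbar≡pathCount m (n ∸ k))))) ⟨
    ∑ n (λ k → natK K (pathCoeff m k) * natK K (fbar m (n ∸ k))) ∎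

-- Here the two sides of the theorem meet: the Catalan coefficients at multiples of m are those of
-- the m-column building.
pathCoeff-1 : ∀ m′ k → pathCoeff 1 (suc m′ ℕ.* k) ≡ pathCoeff (suc m′) k
pathCoeff-1 m′ zero    rewrite ℕ.*-zeroʳ m′ = ≡.refl
pathCoeff-1 m′ (suc k) = ≡.cong₂ (λ x y → (x ∸ 1) C (y ∸ 1))
  (≡.sym (ℕ.*-assoc 2 (suc m′) (suc k))) (ℕ.*-identityˡ (suc m′ ℕ.* suc k))

-- The product of Catalan series over the m-th roots of unity

module RootsOfUnity (K : CommutativeRing 0ℓ 0ℓ) (isField : IsField K) (char0 : CharZero K)
  (m′ : ℕ) (ξ : CommutativeRing.Carrier K) (isPrimitive : PrimitiveRoot K (suc m′) ξ) where
  open CommutativeRing K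
  open PowerSeries K
  open Evaluation K using (pathCount-recurrence)
  open FbarRecurrence K m′
  open FieldODE K isField char0
  open SetoidReasoning setoid
  private
    module S = CommutativeRing seriesRing
    module *-CS = CSProps *-commutativeSemigroup
    m = suc m′
    F = FbarAtRoot K m

  logDeriv : Carrier → ℕ → Carrier
  logDeriv a j = natK K (pathCoeff 1 j) * powK K a j

  -- The case m = 1 of the path recurrence, rescaled by powers of a: `logDeriv a` is the Euler
  -- logarithmic derivative of C(ay).
  D-catalanAt : ∀ a → D (catalanAt K a) ≋ catalanAt K a ⊛ logDeriv a
  D-catalanAt a n = begin
    natK K n * (natK K (catalan n) * powK K a n)
      ≈⟨ *-assoc _ _ _ ⟨
    natK K n * natK K (catalan n) * powK K a n
      ≡⟨ ≡.cong (λ c → natK K n * natK K c * powK K a n) (f≡catalan n) ⟨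
    natK K n * natK K (f n) * powK K a n
      ≈⟨ *-congʳ (pathCount-recurrence 0 n) ⟩
    ∑ n (λ k → natK K (pathCoeff 1 k) * natK K (f (n ∸ k))) * powK K a n
      ≈⟨ *-distribʳ-∑ n _ _ ⟩
    ∑ n (λ k → natK K (pathCoeff 1 k) * natK K (f (n ∸ k)) * powK K a n)
      ≈⟨ ∑-cong n term ⟩
    (logDeriv a ⊛ catalanAt K a) n
      ≈⟨ ⊛-comm (logDeriv a) (catalanAt K a) n ⟩
    (catalanAt K a ⊛ logDeriv a) n ∎
    where
    f = λ n → pathCount 1 (1 ℕ.* n) (1 ℕ.* n)
    f≡catalan : ∀ n → f n ≡ catalan n
    f≡catalan n = ≡.trans (≡.cong (λ j → pathCount 1 j j) (ℕ.*-identityˡ n)) (pathCount-catalan n)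
    term : ∀ k → k ≤ n → natK K (pathCoeff 1 k) * natK K (f (n ∸ k)) * powK K a n
      ≈ logDeriv a k * catalanAt K a (n ∸ k)
    term k k≤n = begin
      natK K (pathCoeff 1 k) * natK K (f (n ∸ k)) * powK K a n
        ≡⟨ ≡.cong₂ (λ c j → natK K (pathCoeff 1 k) * natK K c * powK K a j)
             (f≡catalan (n ∸ k)) (≡.sym (ℕ.m+[n∸m]≡n k≤n)) ⟩
      natK K (pathCoeff 1 k) * natK K (catalan (n ∸ k)) * powK K a (k ℕ.+ (n ∸ k))
        ≈⟨ *-congˡ (powK-+ a k (n ∸ k)) ⟩
      natK K (pathCoeff 1 k) * natK K (catalan (n ∸ k)) * (powK K a k * powK K a (n ∸ k))
        ≈⟨ *-CS.interchange _ _ _ _ ⟩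
      logDeriv a k * catalanAt K a (n ∸ k) ∎

  logDerivs : ℕ → ℕ → Carrier
  logDerivs zero    = S.0#
  logDerivs (suc k) = logDerivs k ⊕ logDeriv (powK K ξ (suc k))

  D-prodCatalan : ∀ k → D (prodCatalan K k ξ) ≋ prodCatalan K k ξ ⊛ logDerivs k
  D-prodCatalan zero    n = trans (D-one n) (sym (S.zeroʳ (prodCatalan K 0 ξ) n))
    where
    D-one : D (prodCatalan K 0 ξ) ≋ S.0#
    D-one zero    = zeroˡ _
    D-one (suc n) = zeroʳ _
  D-prodCatalan (suc k) n = begin
    D (P ⊛ c) n                               ≈⟨ D-⊛ P c n ⟩
    (D P ⊛ c) n + (P ⊛ D c) n                 ≈⟨ +-cong (⊛-cong {g = c} (D-prodCatalan k) (λ _ → refl) n)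
                                                        (⊛-cong {P} (λ _ → refl) (D-catalanAt (powK K ξ (suc k))) n) ⟩
    ((P ⊛ Λ) ⊛ c) n + (P ⊛ (c ⊛ λ′)) n        ≈⟨ +-cong (S.*-assoc P Λ c n) (sym (S.*-assoc P c λ′ n)) ⟩
    (P ⊛ (Λ ⊛ c)) n + ((P ⊛ c) ⊛ λ′) n        ≈⟨ +-congʳ (⊛-cong {P} (λ _ → refl) (⊛-comm Λ c) n) ⟩
    (P ⊛ (c ⊛ Λ)) n + ((P ⊛ c) ⊛ λ′) n        ≈⟨ +-congʳ (S.*-assoc P c Λ n) ⟨
    ((P ⊛ c) ⊛ Λ) n + ((P ⊛ c) ⊛ λ′) n        ≈⟨ S.distribˡ (P ⊛ c) Λ λ′ n ⟨
    ((P ⊛ c) ⊛ (Λ ⊕ λ′)) n                    ∎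
    where
    P = prodCatalan K k ξ
    c = catalanAt K (powK K ξ (suc k))
    Λ = logDerivs k
    λ′ = logDeriv (powK K ξ (suc k))

  logDerivs-geometric : ∀ k j → logDerivs k j ≈ natK K (pathCoeff 1 j) * geometric (powK K ξ j) k
  logDerivs-geometric zero    j = sym (zeroʳ _)
  logDerivs-geometric (suc k) j = trans
    (+-cong (logDerivs-geometric k j) (*-congˡ (begin
      powK K (powK K ξ (suc k)) j    ≈⟨ powK-* ξ (suc k) j ⟨
      powK K ξ (suc k ℕ.* j)         ≡⟨ ≡.cong (powK K ξ) (ℕ.*-comm (suc k) j) ⟩
      powK K ξ (j ℕ.* suc k)         ≈⟨ powK-* ξ j (suc k) ⟩
      powK K (powK K ξ j) (suc k)    ∎)))
    (sym (distribˡ _ _ _))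

  ξ^multiple : ∀ q → powK K ξ (m ℕ.* q) ≈ 1#
  ξ^multiple q = trans (powK-* ξ m q) (trans (powK-cong q (proj₁ isPrimitive)) (powK-one q))

  -- Primitivity at the exponent j mod m gives ξ^j ≠ 1, while ξ^j is still an m-th root of unity, so
  -- its geometric sum vanishes.
  logDerivs-∤ : ∀ j → ¬ (m ∣ j) → logDerivs m j ≈ 0#
  logDerivs-∤ j m∤j = trans (logDerivs-geometric m j)
    (trans (*-congˡ (geometric-zero m ω^m≈1 ω≉1)) (zeroʳ _))
    where
    ω^m≈1 : powK K (powK K ξ j) m ≈ 1#
    ω^m≈1 = trans (sym (powK-* ξ j m))
      (trans (reflexive (≡.cong (powK K ξ) (ℕ.*-comm j m))) (ξ^multiple j))
    reduce : powK K ξ j ≈ powK K ξ (j % m)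
    reduce = begin
      powK K ξ j                                        ≡⟨ ≡.cong (powK K ξ) (m≡m%n+[m/n]*n j m) ⟩
      powK K ξ (j % m ℕ.+ j div m ℕ.* m)                ≈⟨ powK-+ ξ (j % m) _ ⟩
      powK K ξ (j % m) * powK K ξ (j div m ℕ.* m)       ≈⟨ *-congˡ (trans (reflexive (≡.cong (powK K ξ) (ℕ.*-comm (j div m) m))) (ξ^multiple (j div m))) ⟩
      powK K ξ (j % m) * 1#                             ≈⟨ *-identityʳ _ ⟩
      powK K ξ (j % m)                                  ∎
    ω≉1 : ¬ (powK K ξ j ≈ 1#)
    ω≉1 ω≈1 = proj₂ isPrimitive (j % m)
      (ℕ.n≢0⇒n>0 λ j%m≡0 → m∤j (m%n≡0⇒n∣m j m j%m≡0)) (m%n<n j m)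
      (trans (sym reduce) ω≈1)

  logDerivs-multiple : ∀ k → logDerivs m (m ℕ.* k) ≈ natK K m * natK K (pathCoeff m k)
  logDerivs-multiple k = trans (logDerivs-geometric m (m ℕ.* k)) (trans (*-comm _ _) (*-cong
    (geometric-one m (ξ^multiple k))
    (reflexive (≡.cong (natK K) (pathCoeff-1 m′ k)))))

  ∑-multiples : ∀ n {h} → (∀ k → ¬ (m ∣ k) → h k ≈ 0#) → ∑ (m ℕ.* n) h ≈ ∑ n (λ i → h (m ℕ.* i))
  ∑-multiples zero    {h} h≈0 = reflexive (≡.trans
    (≡.cong (λ j → ∑ j h) (ℕ.*-zeroʳ m)) (≡.cong (λ j → 0# + h j) (≡.sym (ℕ.*-zeroʳ m))))
  ∑-multiples (suc n) {h} h≈0 = begin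
    ∑ (m ℕ.* suc n) h                                   ≡⟨ ≡.cong (λ j → ∑ j h) (ℕ.*-suc m n) ⟩
    ∑ (m′ ℕ.+ m ℕ.* n) h + h (suc (m′ ℕ.+ m ℕ.* n))     ≈⟨ +-cong (block m′ ℕ.≤-refl) (reflexive (≡.cong h (≡.sym (ℕ.*-suc m n)))) ⟩
    ∑ (m ℕ.* n) h + h (m ℕ.* suc n)                     ≈⟨ +-congʳ (∑-multiples n h≈0) ⟩
    ∑ n (λ i → h (m ℕ.* i)) + h (m ℕ.* suc n)           ∎
    where
    block : ∀ i → i < m → ∑ (i ℕ.+ m ℕ.* n) h ≈ ∑ (m ℕ.* n) h
    block zero    _   = refl
    block (suc i) i<m = trans (+-cong (block i (ℕ.<-trans (ℕ.n<1+n i) i<m))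
      (h≈0 _ (∤-between-multiples m n i i<m))) (+-identityʳ _)

  F-multiple : ∀ n → F (m ℕ.* n) ≈ natK K (fbar m n)
  F-multiple n with m ∣? (m ℕ.* n)
  ... | yes _  = reflexive (≡.cong (natK K ∘ fbar m)
    (≡.trans (≡.cong (_div m) (ℕ.*-comm m n)) (m*n/n≡m n m)))
  ... | no  m∤ = contradiction (m∣m*n n) m∤

  F-∤ : ∀ j → ¬ (m ∣ j) → F j ≈ 0#
  F-∤ j m∤j with m ∣? j
  ... | yes m∣j = contradiction m∣j m∤j
  ... | no  _   = refl

  Λ⊛F-∤ : ∀ j → ¬ (m ∣ j) → (logDerivs m ⊛ F) j ≈ 0#
  Λ⊛F-∤ j m∤j = ∑-zero j λ k k≤j → term k k≤j (m ∣? k)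
    where
    term : ∀ k → k ≤ j → Dec (m ∣ k) → logDerivs m k * F (j ∸ k) ≈ 0#
    term k k≤j (no  m∤k) = trans (*-congʳ (logDerivs-∤ k m∤k)) (zeroˡ _)
    term k k≤j (yes m∣k) = trans (*-congˡ (F-∤ (j ∸ k) λ m∣j∸k →
      m∤j (∣m∸n∣n⇒∣m m k≤j m∣j∸k m∣k))) (zeroʳ _)

  -- The Euler operator in y gives mn on y^(mn). The n enters the recurrence of `fbar`, and the m is
  -- the number of equal contributions in `logDerivs-multiple`.
  D-F-multiple : ∀ n → D F (m ℕ.* n) ≈ (logDerivs m ⊛ F) (m ℕ.* n)
  D-F-multiple n = begin
    natK K (m ℕ.* n) * F (m ℕ.* n)
      ≈⟨ trans (*-cong (natK-* m n) (F-multiple n)) (*-assoc _ _ _) ⟩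
    natK K m * (natK K n * natK K (fbar m n))
      ≈⟨ trans (*-congˡ (fbar-recurrence n)) (*-distribˡ-∑ n _ _) ⟩
    ∑ n (λ i → natK K m * (natK K (pathCoeff m i) * natK K (fbar m (n ∸ i))))
      ≈⟨ ∑-cong n (λ i _ → trans (sym (*-assoc _ _ _)) (sym (*-cong (logDerivs-multiple i)
           (trans (reflexive (≡.cong F (≡.sym (ℕ.*-distribˡ-∸ m n i)))) (F-multiple (n ∸ i)))))) ⟩
    ∑ n (λ i → logDerivs m (m ℕ.* i) * F (m ℕ.* n ∸ m ℕ.* i))
      ≈⟨ ∑-multiples n (λ k m∤k → trans (*-congʳ (logDerivs-∤ k m∤k)) (zeroˡ _)) ⟨
    (logDerivs m ⊛ F) (m ℕ.* n) ∎

  D-F : D F ≋ F ⊛ logDerivs m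
  D-F j = trans (by-cases (m ∣? j)) (⊛-comm (logDerivs m) F j)
    where
    by-cases : Dec (m ∣ j) → D F j ≈ (logDerivs m ⊛ F) j
    by-cases (no m∤j) = trans (trans (*-congˡ (F-∤ j m∤j)) (zeroʳ _)) (sym (Λ⊛F-∤ j m∤j))
    by-cases (yes (divides n j≡n*m)) = ≡.subst (λ i → D F i ≈ (logDerivs m ⊛ F) i)
      (≡.trans (ℕ.*-comm m n) (≡.sym j≡n*m)) (D-F-multiple n)

  prodCatalan-0 : ∀ k → prodCatalan K k ξ 0 ≈ 1#
  prodCatalan-0 zero    = refl
  prodCatalan-0 (suc k) = trans (+-identityˡ _) (trans
    (*-cong (prodCatalan-0 k) (trans (*-identityʳ _) (+-identityʳ 1#))) (*-identityˡ 1#))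

  prodCatalan≋F : prodCatalan K m ξ ≋ F
  prodCatalan≋F = ode-unique {h = logDerivs m}
    (trans (logDerivs-geometric m 0) (zeroˡ _))
    (trans (prodCatalan-0 m) (sym (trans
      (≡.subst (λ j → F j ≈ natK K 1) (ℕ.*-zeroʳ m) (F-multiple 0)) (+-identityʳ 1#))))
    (D-prodCatalan m) D-F

-- The exponential formula over the rationals

ℚ-ring : CommutativeRing 0ℓ 0ℓ
ℚ-ring = ℚ.+-*-commutativeRing

[1+n]/1≡1+n/1 : ∀ n → (+ suc n) / 1 ≡ ℚ.1ℚ ℚ.+ (+ n) / 1
[1+n]/1≡1+n/1 n = ℚ.toℚᵘ-injective (begin
  ℚ.toℚᵘ ((+ suc n) / 1)           ≈⟨ ℚ.toℚᵘ-fromℚᵘ (mkℚᵘ (+ suc n) 0) ⟩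
  mkℚᵘ (+ suc n) 0                 ≈⟨ *≡* (≡.trans (ℤ.*-identityʳ (+ suc n)) (≡.sym
                                        (≡.trans (ℤ.*-identityʳ (+ 1 ℤ.+ + n ℤ.* + 1))
                                          (≡.cong (ℤ._+_ (+ 1)) (ℤ.*-identityʳ (+ n)))))) ⟩
  ℚᵘ.1ℚᵘ ℚᵘ.+ mkℚᵘ (+ n) 0         ≈⟨ ℚᵘ.+-congʳ ℚᵘ.1ℚᵘ (ℚ.toℚᵘ-fromℚᵘ (mkℚᵘ (+ n) 0)) ⟨
  ℚᵘ.1ℚᵘ ℚᵘ.+ ℚ.toℚᵘ ((+ n) / 1)   ≈⟨ ℚ.toℚᵘ-homo-+ ℚ.1ℚ ((+ n) / 1) ⟨
  ℚ.toℚᵘ (ℚ.1ℚ ℚ.+ (+ n) / 1)      ∎)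
  where open SetoidReasoning ℚᵘ.≃-setoid

-- Since `_/_` reduces to lowest terms, the equality is checked by cross-multiplication of
-- unnormalised fractions.
/-*-/ : ∀ a b c d e f → a ℕ.* c ℕ.* suc f ≡ e ℕ.* (suc b ℕ.* suc d) →
  ((+ a) / suc b) ℚ.* ((+ c) / suc d) ≡ (+ e) / suc f
/-*-/ a b c d e f eq = ℚ.toℚᵘ-injective (begin
  ℚ.toℚᵘ (((+ a) / suc b) ℚ.* ((+ c) / suc d))
    ≈⟨ ℚ.toℚᵘ-homo-* ((+ a) / suc b) ((+ c) / suc d) ⟩
  ℚ.toℚᵘ ((+ a) / suc b) ℚᵘ.* ℚ.toℚᵘ ((+ c) / suc d)
    ≈⟨ ℚᵘ.*-cong (ℚ.toℚᵘ-fromℚᵘ (mkℚᵘ (+ a) b)) (ℚ.toℚᵘ-fromℚᵘ (mkℚᵘ (+ c) d)) ⟩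
  mkℚᵘ (+ a) b ℚᵘ.* mkℚᵘ (+ c) d
    ≈⟨ *≡* (≡.trans (≡.cong (ℤ._* + suc f) (≡.sym (ℤ.pos-* a c)))
         (≡.trans (≡.sym (ℤ.pos-* (a ℕ.* c) (suc f)))
           (≡.trans (≡.cong +_ eq) (ℤ.pos-* e (suc b ℕ.* suc d))))) ⟩
  mkℚᵘ (+ e) f
    ≈⟨ ℚ.toℚᵘ-fromℚᵘ (mkℚᵘ (+ e) f) ⟨
  ℚ.toℚᵘ ((+ e) / suc f) ∎)
  where open SetoidReasoning ℚᵘ.≃-setoid

natK-ℚ : ∀ n → natK ℚ-ring n ≡ (+ n) / 1
natK-ℚ zero    = ≡.refl
natK-ℚ (suc n) = ≡.trans (≡.cong (ℚ._+_ ℚ.1ℚ) (natK-ℚ n)) (≡.sym ([1+n]/1≡1+n/1 n))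

ℚ-isField : IsField ℚ-ring
ℚ-isField = (λ ()) , λ x x≢0 → (ℚ.1/ x) {{ℚ.≢-nonZero x≢0}} , ℚ.*-inverseʳ x {{ℚ.≢-nonZero x≢0}}

ℚ-charZero : CharZero ℚ-ring
ℚ-charZero n eq with ℚᵘ.≃-trans (ℚᵘ.≃-sym (ℚ.toℚᵘ-fromℚᵘ (mkℚᵘ (+ suc n) 0)))
  (ℚᵘ.≃-reflexive (≡.cong ℚ.toℚᵘ (≡.trans (≡.sym (natK-ℚ (suc n))) eq)))
... | *≡* ()

-- With e = d! this is the hypothesis `w-suc` for the weights 1/k!, as (d+1)! unfolds to (d+1) d!.
unit-fraction-* : ∀ d e .{{_ : NonZero (suc d ℕ.* e)}} .{{_ : NonZero e}} →
  ((+ 1) / (suc d ℕ.* e)) ℚ.* natK ℚ-ring (suc d) ≡ (+ 1) / e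
unit-fraction-* d (suc e) = ≡.trans (≡.cong (ℚ._*_ ((+ 1) / (suc d ℕ.* suc e))) (natK-ℚ (suc d)))
  (/-*-/ 1 (e ℕ.+ d ℕ.* suc e) (suc d) 0 1 e
    (solve 2 (λ d e → con 1 :* d :* e := con 1 :* (d :* e :* con 1)) ≡.refl (suc d) (suc e)))
  where open +-*-Solver

module RationalExponential (m′ : ℕ) where
  private
    m = suc m′
  open PowerSeries ℚ-ring
  open FbarRecurrence ℚ-ring m′ using (fbar-recurrence)

  inverseFactorial : ℕ → ℚ
  inverseFactorial k = ((+ 1) / (k !)) {{k ℕ.!≢0}}

  powPSℚ-zero : ∀ G → powPSℚ G 0 ≋ one
  powPSℚ-zero G zero    = ≡.refl
  powPSℚ-zero G (suc n) = ≡.refl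

  D-expPSℚ : ∀ G → G 0 ≡ ℚ.0ℚ → D (expPSℚ G) ≋ expPSℚ G ⊛ D G
  D-expPSℚ G G₀≡0 = Exponential.D-exp ℚ-ring inverseFactorial
    (λ k → unit-fraction-* k (k !) {{suc k ℕ.!≢0}} {{k ℕ.!≢0}}) G G₀≡0
    (powPSℚ G) (powPSℚ-zero G) (λ k n → ≡.refl)

  D-expArg : ∀ n → natK ℚ-ring (pathCoeff m n) ≡ D (expArg m) n
  D-expArg zero      = ≡.refl
  D-expArg n@(suc k) = ≡.trans (natK-ℚ c) (≡.sym (≡.trans (≡.cong (λ x → x ℚ.* expArg m n) (natK-ℚ n))
    (/-*-/ n 0 c k c 0
      (solve 2 (λ n c → n :* c :* con 1 := c :* (con 1 :* n)) ≡.refl n c))))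
    where
    open +-*-Solver
    c = pathCoeff m n

  F : ℕ → ℚ
  F n = natK ℚ-ring (fbar m n)

  D-F : D F ≋ F ⊛ D (expArg m)
  D-F n = ≡.trans (fbar-recurrence n) (≡.trans
    (∑-cong n λ k _ → ≡.cong (λ x → x ℚ.* F (n ∸ k)) (D-expArg k)) (⊛-comm (D (expArg m)) F n))

  fbar≡expPSℚ : ∀ n → (+ fbar m n) / 1 ≡ expPSℚ (expArg m) n
  fbar≡expPSℚ n = ≡.trans (≡.sym (natK-ℚ (fbar m n)))
    (FieldODE.ode-unique ℚ-ring ℚ-isField ℚ-charZero {h = D (expArg m)} ≡.refl ≡.refl
      D-F (D-expPSℚ (expArg m) ≡.refl) n)

theorem1p1 : (m : ℕ) → .{{_ : NonZero m}} →
    ((K : CommutativeRing 0ℓ 0ℓ) → IsField K → CharZero K →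
    (ξ : CommutativeRing.Carrier K) → PrimitiveRoot K m ξ →
    ∀ (j : ℕ) → CommutativeRing._≈_ K (prodCatalan K m ξ j) (FbarAtRoot K m j))
    × (∀ (n : ℕ) → (+ fbar m n) / 1 ≡ expPSℚ (expArg m) n)
theorem1p1 zero     = contradiction ≡.refl (ℕ.≢-nonZero⁻¹ 0)
theorem1p1 (suc m′) = (λ K isField char0 ξ isPrimitive →
    RootsOfUnity.prodCatalan≋F K isField char0 m′ ξ isPrimitive)
  , RationalExponential.fbar≡expPSℚ m′
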